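{- For $m,n\geq2$ and $d\geq0$, the number of Fibonacci polyominoes $P\in\mathcal F_{m,n}$ with $\operatorname{des}(P)=d$ equals \[ N(m,d+1)\binom{n-2}{m-1}+N(m-1,d)\binom{n-2}{m-2}. \] For $m=1$, the unique polyomino in $\mathcal F_{1,n}$ has no descents.
   Context: A Fibonacci polyomino is a (nonempty) polyomino, considered up to translation, that is column-convex (each column is a contiguous segment of unit cells) and such that, reading columns from left to right, the bottom cell of each column lies exactly one unit above the bottom cell of the preceding column. Equivalently, it is given by a sequence of column heights $(h_1,\dots,h_m)$, $m\ge 1$, with $h_i\ge 2$ for $1\le i\le m-1$ and $h_m\ge 1$; column $i$ consists of the cells in column position $i$ and rows $i,i+1,\dots,i+h_i-1$. The horizontal (resp. vertical) semiperimeter is half the number of horizontal (resp. vertical) unit edges on the boundary (edges belonging to exactly one cell). $\mathcal F_{m,n}$ is the set of Fibonacci polyominoes with horizontal semiperimeter $m$ (equivalently $m$ columns) and vertical semiperimeter $n$. For $P$ with column heights $(h_1,\ldots,h_m)$, the number of descents is $\operatorname{des}(P)=|\{i:1\le i<m,\ h_i>h_{i+1}\}|$. Narayana numbers: $N(\ell,k)=\frac1\ell\binom{\ell}{k}\binom{\ell}{k-1}$ for $1\le k\le\ell$, and $N(\ell,k)=0$ outside this range. Binomial coefficients $\binom ab$ with $a\ge0$ vanish if $b<0$ or $b>a$. -}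

module Defs where

open import Data.Bool.Base using (if_then_else_)
open import Data.List.Base using (List; []; _∷_; _++_; map; upTo; concatMap; filter; length)
open import Data.Nat.Base using (ℕ; zero; suc; _+_; _*_; _≤_; _/_)
open import Data.Nat.Combinatorics using (_C_; nCk+nC[k+1]≡[n+1]C[k+1]; nC1≡n)
open import Data.Nat.Divisibility using (_∣_; ∣m+n∣m⇒∣n; m∣m*n)
open import Data.Nat.Properties using (_≟_; _<?_; *-comm)
open import Data.Nat.Tactic.RingSolver using (solve-∀)
open import Data.Product.Base using (Σ-syntax; _×_; _,_)
open import Data.Product.Properties using (≡-dec)
open import Relation.Binary.Definitions using (DecidableEquality)
open import Relation.Binary.PropositionalEquality using (_≡_; refl; trans; cong; cong₂; subst; module ≡-Reasoning)
open import Relation.Nullary.Decidable.Core using (does)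

data IsHeightSequence : List ℕ → Set where
  final : ∀ {h} → 1 ≤ h → IsHeightSequence (h ∷ [])
  step  : ∀ {h h′ hs} → 2 ≤ h → IsHeightSequence (h′ ∷ hs) →
          IsHeightSequence (h ∷ h′ ∷ hs)

-- A Fibonacci polyomino up to translation, given by its column heights
-- from left to right.
record FibonacciPolyomino : Set where
  constructor polyomino
  field
    heights  : List ℕ
    isHeight : IsHeightSequence heights

open FibonacciPolyomino public

-- (x , y) is the unit square [x , x + 1] × [y , y + 1].
Cell : Set
Cell = ℕ × ℕ

-- The cells of the columns with the given heights, the first of them being
-- column i; column i occupies the rows i , … , i + h − 1.
cellsFrom : ℕ → List ℕ → List Cell
cellsFrom i []       = []
cellsFrom i (h ∷ hs) = map (λ j → i , i + j) (upTo h) ++ cellsFrom (suc i) hs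

cells : FibonacciPolyomino → List Cell
cells P = cellsFrom 1 (heights P)

-- A unit edge is named by its left endpoint if it is horizontal, and by its
-- lower endpoint if it is vertical.
Edge : Set
Edge = ℕ × ℕ

_≟ᴱ_ : DecidableEquality Edge
_≟ᴱ_ = ≡-dec _≟_ _≟_

horizontalEdges : Cell → List Edge
horizontalEdges (x , y) = (x , y) ∷ (x , suc y) ∷ []

verticalEdges : Cell → List Edge
verticalEdges (x , y) = (x , y) ∷ (suc x , y) ∷ []

occurrences : Edge → List Edge → ℕ
occurrences e es = length (filter (e ≟ᴱ_) es)

-- When es concatenates the edges of distinct cells, the number of occurrences
-- of an edge is the number of cells it belongs to.
occurringOnce : List Edge → List Edge
occurringOnce es = filter (λ e → occurrences e es ≟ 1) es

horizontalBoundary : FibonacciPolyomino → List Edge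
horizontalBoundary P = occurringOnce (concatMap horizontalEdges (cells P))

verticalBoundary : FibonacciPolyomino → List Edge
verticalBoundary P = occurringOnce (concatMap verticalEdges (cells P))

HasHorizontalSemiperimeter : FibonacciPolyomino → ℕ → Set
HasHorizontalSemiperimeter P m = length (horizontalBoundary P) ≡ 2 * m

HasVerticalSemiperimeter : FibonacciPolyomino → ℕ → Set
HasVerticalSemiperimeter P n = length (verticalBoundary P) ≡ 2 * n

-- Equality in 𝓕 m n is equality of height sequences: the remaining components
-- are proofs of propositions.
𝓕 : ℕ → ℕ → Set
𝓕 m n = Σ[ P ∈ FibonacciPolyomino ]
          (HasHorizontalSemiperimeter P m × HasVerticalSemiperimeter P n)

descents : List ℕ → ℕ
descents []            = 0
descents (h ∷ [])      = 0
descents (h ∷ h′ ∷ hs) =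
  (if does (h′ <? h) then 1 else 0) + descents (h′ ∷ hs)

des : FibonacciPolyomino → ℕ
des P = descents (heights P)

-- N(ℓ , k) = (1/ℓ) (ℓ C k) (ℓ C (k − 1)). The division is exact (see
-- narayana-exact), and for k > ℓ the value is 0 because ℓ C k = 0.
narayana : ℕ → ℕ → ℕ
narayana zero      k       = 0
narayana (suc ℓ)   zero    = 0
narayana ℓ@(suc _) (suc k) = ((ℓ C suc k) * (ℓ C k)) / ℓ

private
  absorption : ∀ n k → suc k * (suc n C suc k) ≡ suc n * (n C k)
  absorption zero    zero    = refl
  absorption zero    (suc k) = *-comm (suc (suc k)) 0
  absorption (suc n) zero    = trans (cong (1 *_) (nC1≡n (2 + n))) (*-comm 1 (2 + n))
  absorption (suc n) (suc k) = begin
    (2 + k) * (suc (suc n) C suc (suc k))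
      ≡⟨ cong ((2 + k) *_) (nCk+nC[k+1]≡[n+1]C[k+1] (suc n) (suc k)) ⟨
    (2 + k) * (a + b)
      ≡⟨ expand k a b ⟩
    a + (suc k * a + (2 + k) * b)
      ≡⟨ cong (a +_) (cong₂ _+_ (absorption n k) (absorption n (suc k))) ⟩
    a + (suc n * (n C k) + suc n * (n C suc k))
      ≡⟨ collect n a (n C k) (n C suc k) ⟩
    a + suc n * ((n C k) + (n C suc k))
      ≡⟨ cong (λ c → a + suc n * c) (nCk+nC[k+1]≡[n+1]C[k+1] n k) ⟩
    (2 + n) * a ∎
    where
    open ≡-Reasoning
    a = suc n C suc k
    b = suc n C suc (suc k)
    expand : ∀ k a b → (2 + k) * (a + b) ≡ a + ((1 + k) * a + (2 + k) * b)
    expand = solve-∀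
    collect : ∀ n a c d → a + ((1 + n) * c + (1 + n) * d) ≡ a + (1 + n) * (c + d)
    collect = solve-∀

narayana-exact : ∀ ℓ k → suc ℓ ∣ (suc ℓ C suc k) * (suc ℓ C k)
narayana-exact ℓ k =
  ∣m+n∣m⇒∣n (subst (suc ℓ ∣_) eq (m∣m*n (c * (a + b)))) (m∣m*n (a * b))
  where
  open ≡-Reasoning
  a = suc ℓ C suc k
  b = suc ℓ C k
  c = ℓ C k
  regroup₁ : ∀ ℓ a b c → (1 + ℓ) * (c * (a + b)) ≡ ((1 + ℓ) * c) * (a + b)
  regroup₁ = solve-∀
  regroup₂ : ∀ k a b → ((1 + k) * a) * (a + b) ≡ a * ((1 + k) * (b + a))
  regroup₂ = solve-∀
  regroup₃ : ∀ ℓ a b → a * ((2 + ℓ) * b) ≡ (1 + ℓ) * (a * b) + a * b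
  regroup₃ = solve-∀
  eq : suc ℓ * (c * (a + b)) ≡ suc ℓ * (a * b) + a * b
  eq = begin
    suc ℓ * (c * (a + b))     ≡⟨ regroup₁ ℓ a b c ⟩
    (suc ℓ * c) * (a + b)     ≡⟨ cong (_* (a + b)) (absorption ℓ k) ⟨
    (suc k * a) * (a + b)     ≡⟨ regroup₂ k a b ⟩
    a * (suc k * (b + a))
      ≡⟨ cong (λ x → a * (suc k * x)) (nCk+nC[k+1]≡[n+1]C[k+1] (suc ℓ) k) ⟩
    a * (suc k * (suc (suc ℓ) C suc k)) ≡⟨ cong (a *_) (absorption (suc ℓ) k) ⟩
    a * ((2 + ℓ) * b)         ≡⟨ regroup₃ ℓ a b ⟩
    suc ℓ * (a * b) + a * b ∎

{-# OPTIONS --safe #-}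
module Submission where

-- Grouping the vertical edges by abscissa shows that the vertical semiperimeter
-- is h₁ + Σ max(0, 1 + hᵢ₊₁ − hᵢ). Reading the columns from the left, the height
-- sequences with d descents, e non-descents, first height 2 + g and
-- Σ max(0, 1 + hᵢ₊₁ − hᵢ) = e + r satisfy a linear recurrence in (d , e , r , g).
-- If all heights are at least 2, its solution is, as in the reflection principle, a
-- difference of two products of binomial coefficients; summing over the first
-- height gives (C(m−1,d)² − C(m−1,d+1) C(m−1,d−1)) C(n−2,m−1), in which the
-- bracket is N(m,d+1). Removing a last column of height 1 yields the same count
-- for (m−1 , d−1), hence the second summand.

open import Defs
open import Data.Bool.Base using (if_then_else_)
open import Data.Empty using (⊥-elim)
open import Data.Fin.Base using (Fin)
open import Data.Fin.Properties using (+↔⊎; 1↔⊤)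
open import Data.List.Base using (List; []; _∷_; _++_; map; upTo; applyUpTo; concatMap; filter; length)
open import Data.List.Membership.Propositional using (_∈_)
open import Data.List.Properties using (length-++; filter-++; filter-all; filter-none; filter-≐; filter-accept; filter-reject; concatMap-++; map-upTo; map-∘; ++-assoc; ∷-injective)
open import Data.List.Relation.Binary.Permutation.Propositional using (_↭_; prep; ↭-refl; ↭-sym; ↭-trans; ↭-reflexive)
open import Data.List.Relation.Binary.Permutation.Propositional.Properties as Perm using (↭-length; filter-↭; shift)
open import Data.List.Relation.Unary.All as All using (All; []; _∷_)
open import Data.List.Relation.Unary.All.Properties using (++⁺)
open import Data.List.Relation.Unary.AllPairs using ([]; _∷_)
open import Data.List.Relation.Unary.Any using (here; there)
open import Data.List.Relation.Unary.Unique.Propositional using (Unique)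
open import Data.Nat.Base
open import Data.Nat.Combinatorics using (_C_; nCk+nC[k+1]≡[n+1]C[k+1]; k>n⇒nCk≡0; nCn≡1; nC1≡n; nCk≡nC[n∸k])
open import Data.Nat.DivMod using (m/n*n≡m)
open import Data.Nat.Properties
open import Data.Nat.Tactic.RingSolver using (solve-∀)
open import Data.Product.Base using (Σ-syntax; ∃-syntax; _×_; _,_; proj₁; proj₂)
open import Data.Sum.Base using (_⊎_; inj₁; inj₂)
open import Data.Sum.Function.Propositional using (_⊎-↔_)
open import Data.Unit.Base using (tt)
open import Function.Base using (_∘_)
open import Function.Bundles using (_↔_; mk↔ₛ′)
open import Function.Properties.Inverse using (↔-sym; ↔-trans)
open import Relation.Binary.PropositionalEquality
open import Relation.Nullary using (yes; no; ¬_; contradiction)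
open import Relation.Nullary.Decidable using (dec-true; dec-false)
open import Relation.Unary using (Decidable)
open ≡-Reasoning

-- Boundary edges

-- Descents can be read off the semiperimeter because max(0, 1 + hᵢ₊₁ - hᵢ) vanishes exactly at a
-- descent and is at least 1 otherwise. So m and d fix e = m - 1 - d, each non-descent costs one
-- forced unit of rise, and only the excess r varies. With first height 2 + g this gives n = 2 + e +
-- (r + g): the first height enters only through r + g.
--
-- The lower bound 2 on the heights couples drops with rises, which rules out a single product. Two
-- products solve the recurrence: in each, Pascal's rule on the coefficient C(d + e, d) or C(d + e,
-- d + 1) decides whether the first step is a descent, and Pascal's rule on the other factor decides
-- the size of that step. Their difference is the right solution because they agree on sequences
-- that start with a descent from height 2, of which there are none.
--
-- Truncated subtraction would spoil the linear algebra, so every such difference is stated with the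
-- subtracted term moved to the other side.

occurrences-++ : ∀ e xs ys → occurrences e (xs ++ ys) ≡ occurrences e xs + occurrences e ys
occurrences-++ e xs ys = trans (cong length (filter-++ (e ≟ᴱ_) xs ys)) (length-++ (filter (e ≟ᴱ_) xs))

occurrences-↭ : ∀ {xs ys} e → xs ↭ ys → occurrences e xs ≡ occurrences e ys
occurrences-↭ e p = ↭-length (filter-↭ (e ≟ᴱ_) p)

∉⇒occurrences≡0 : ∀ {e} xs → All (e ≢_) xs → occurrences e xs ≡ 0
∉⇒occurrences≡0 {e} xs e∉xs = cong length (filter-none (e ≟ᴱ_) e∉xs)

∈⇒1≤occurrences : ∀ {e xs} → e ∈ xs → 1 ≤ occurrences e xs
∈⇒1≤occurrences {e} {x ∷ xs} e∈xs with e ≟ᴱ x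
... | yes _ = s≤s z≤n
∈⇒1≤occurrences (here e≡x)   | no e≢x = contradiction e≡x e≢x
∈⇒1≤occurrences (there e∈xs) | no _   = ∈⇒1≤occurrences e∈xs

unique⇒occurrences≡1 : ∀ {e xs} → Unique xs → e ∈ xs → occurrences e xs ≡ 1
unique⇒occurrences≡1 {e} {x ∷ xs} (x∉xs ∷ u) e∈ with e ≟ᴱ x
... | yes refl = cong suc (∉⇒occurrences≡0 xs x∉xs)
unique⇒occurrences≡1 (x∉xs ∷ u) (here e≡x)   | no e≢x = contradiction e≡x e≢x
unique⇒occurrences≡1 (x∉xs ∷ u) (there e∈xs) | no _   = unique⇒occurrences≡1 u e∈xs

#once : List Edge → ℕ
#once es = length (occurringOnce es)

#once-↭ : ∀ {xs ys} → xs ↭ ys → #once xs ≡ #once ys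
#once-↭ {xs} {ys} p = trans
  (cong length (filter-≐ (λ e → occurrences e xs ≟ 1) (λ e → occurrences e ys ≟ 1)
    ((λ {e} → trans (sym (occurrences-↭ e p))) , (λ {e} → trans (occurrences-↭ e p))) xs))
  (↭-length (filter-↭ (λ e → occurrences e ys ≟ 1) p))

Disjoint : List Edge → List Edge → Set
Disjoint xs ys = All (λ x → All (x ≢_) ys) xs

Disjoint-sym : ∀ {xs ys} → Disjoint xs ys → Disjoint ys xs
Disjoint-sym dis = All.tabulate λ y∈ys → All.tabulate λ x∈xs y≡x →
  All.lookup (All.lookup dis x∈xs) y∈ys (sym y≡x)

filter-cong-All : ∀ {A : Set} {P Q : A → Set} (P? : Decidable P) (Q? : Decidable Q) {xs} →
  All (λ x → (P x → Q x) × (Q x → P x)) xs → filter P? xs ≡ filter Q? xs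
filter-cong-All P? Q? []                                = refl
filter-cong-All P? Q? (_∷_ {x} (P⇒Q , Q⇒P) eqs) with P? x
... | yes Px = trans (cong (x ∷_) (filter-cong-All P? Q? eqs)) (sym (filter-accept Q? (P⇒Q Px)))
... | no ¬Px = trans (filter-cong-All P? Q? eqs) (sym (filter-reject Q? (¬Px ∘ Q⇒P)))

#once-++ : ∀ xs ys → Disjoint xs ys → #once (xs ++ ys) ≡ #once xs + #once ys
#once-++ xs ys dis = begin
  length (filter once? (xs ++ ys))                 ≡⟨ cong length (filter-++ once? xs ys) ⟩
  length (filter once? xs ++ filter once? ys)      ≡⟨ length-++ (filter once? xs) ⟩
  length (filter once? xs) + length (filter once? ys)
    ≡⟨ cong₂ (λ as bs → length as + length bs)
         (filter-cong-All _ _ (All.map (both ∘ inˡ) dis))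
         (filter-cong-All _ _ (All.map (both ∘ inʳ) (Disjoint-sym dis))) ⟩
  #once xs + #once ys ∎
  where
  once? = λ e → occurrences e (xs ++ ys) ≟ 1
  both : ∀ {m n : ℕ} → m ≡ n → (m ≡ 1 → n ≡ 1) × (n ≡ 1 → m ≡ 1)
  both m≡n = trans (sym m≡n) , trans m≡n
  inˡ : ∀ {e} → All (e ≢_) ys → occurrences e (xs ++ ys) ≡ occurrences e xs
  inˡ {e} e∉ys = begin
    occurrences e (xs ++ ys)              ≡⟨ occurrences-++ e xs ys ⟩
    occurrences e xs + occurrences e ys   ≡⟨ cong (occurrences e xs +_) (∉⇒occurrences≡0 ys e∉ys) ⟩
    occurrences e xs + 0                  ≡⟨ +-identityʳ _ ⟩
    occurrences e xs                      ∎
  inʳ : ∀ {e} → All (e ≢_) xs → occurrences e (xs ++ ys) ≡ occurrences e ys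
  inʳ {e} e∉xs = trans (occurrences-++ e xs ys) (cong (_+ occurrences e ys) (∉⇒occurrences≡0 xs e∉xs))

#once-unique : ∀ {xs} → Unique xs → #once xs ≡ length xs
#once-unique u = cong length (filter-all _ (All.tabulate (unique⇒occurrences≡1 u)))

#once-doubled : ∀ xs → #once (xs ++ xs) ≡ 0
#once-doubled xs = cong length (filter-none _ (++⁺ twice twice))
  where
  twice : All (λ e → occurrences e (xs ++ xs) ≢ 1) xs
  twice = All.tabulate λ {e} e∈xs eq →
    <-irrefl (sym (trans (sym (occurrences-++ e xs xs)) eq))
      (+-mono-≤ (∈⇒1≤occurrences e∈xs) (∈⇒1≤occurrences e∈xs))

#once-cancel : ∀ xs ys → Disjoint xs ys → Unique ys → #once (xs ++ xs ++ ys) ≡ length ys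
#once-cancel xs ys dis u = begin
  #once (xs ++ xs ++ ys)           ≡⟨ cong #once (++-assoc xs xs ys) ⟨
  #once ((xs ++ xs) ++ ys)         ≡⟨ #once-++ (xs ++ xs) ys (++⁺ dis dis) ⟩
  #once (xs ++ xs) + #once ys      ≡⟨ cong₂ _+_ (#once-doubled xs) (#once-unique u) ⟩
  length ys                        ∎

-- Stacks of consecutive edges at one abscissa

segment : ℕ → ℕ → ℕ → List Edge
segment x y zero    = []
segment x y (suc k) = (x , y) ∷ segment x (suc y) k

segment-+ : ∀ x y k l → segment x y (k + l) ≡ segment x y k ++ segment x (y + k) l
segment-+ x y zero    l = cong (λ z → segment x z l) (sym (+-identityʳ y))
segment-+ x y (suc k) l = cong ((x , y) ∷_) (trans (segment-+ x (suc y) k l)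
  (cong (λ z → segment x (suc y) k ++ segment x z l) (sym (+-suc y k))))

length-segment : ∀ x y k → length (segment x y k) ≡ k
length-segment x y zero    = refl
length-segment x y (suc k) = cong suc (length-segment x (suc y) k)

segment-All : ∀ {P : Edge → Set} x y k → (∀ z → y ≤ z → z < y + k → P (x , z)) → All P (segment x y k)
segment-All x y zero    h = []
segment-All x y (suc k) h = h y ≤-refl (m<m+n y (s≤s z≤n)) ∷
  segment-All x (suc y) k λ z y<z z<y+k → h z (<⇒≤ y<z) (subst (z <_) (sym (+-suc y k)) z<y+k)

segment-Unique : ∀ x y k → Unique (segment x y k)
segment-Unique x y zero    = []
segment-Unique x y (suc k) =
  segment-All x (suc y) k (λ z y<z _ eq → <-irrefl (cong proj₂ eq) y<z) ∷ segment-Unique x (suc y) k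

#once-segment : ∀ x y k → #once (segment x y k) ≡ k
#once-segment x y k = trans (#once-unique (segment-Unique x y k)) (length-segment x y k)

#once-overlap : ∀ x y k t → 
  #once ((x , y) ∷ segment x (suc y) k ++ segment x (suc y) k ++ segment x (suc y + k) t) ≡ suc t
#once-overlap x y k t = begin
  #once ((x , y) ∷ s ++ s ++ s′)   ≡⟨ #once-↭ (↭-trans (↭-sym (shift _ s (s ++ s′))) (Perm.++⁺ˡ s (↭-sym (shift _ s s′)))) ⟩
  #once (s ++ s ++ (x , y) ∷ s′)   ≡⟨ #once-cancel s ((x , y) ∷ s′) dis unique ⟩
  suc (length s′)                  ≡⟨ cong suc (length-segment x (suc y + k) t) ⟩
  suc t                            ∎
  where
  s = segment x (suc y) k
  s′ = segment x (suc y + k) t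
  dis : Disjoint s ((x , y) ∷ s′)
  dis = segment-All x (suc y) k λ z y<z z<y+k →
    (λ eq → <-irrefl (sym (cong proj₂ eq)) y<z) ∷
    segment-All x (suc y + k) t (λ w y+k≤w _ eq → <-irrefl (cong proj₂ eq) (<-≤-trans z<y+k y+k≤w))
  unique : Unique ((x , y) ∷ s′)
  unique = segment-All x (suc y + k) t
    (λ w y+k≤w _ eq → <-irrefl (cong proj₂ eq) (≤-trans (m≤m+n (suc y) k) y+k≤w)) ∷ segment-Unique x (suc y + k) t

-- This is the line between neighbouring columns of heights `suc k` and `l`, the right one starting
-- one unit higher. The common stretch cancels; what survives is the bottom edge of the left column
-- and the part by which one column overtops the other. At most one of the two truncated differences
-- is nonzero.
#once-adjacent : ∀ x y k l →
  #once (segment x y (suc k) ++ segment x (suc y) l) ≡ suc ((k ∸ l) + (l ∸ k))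
#once-adjacent x y k l with ≤-total k l
... | inj₁ k≤l = begin
  #once ((x , y) ∷ s ++ segment x (suc y) l)
    ≡⟨ cong (λ n → #once ((x , y) ∷ s ++ segment x (suc y) n)) (m+[n∸m]≡n k≤l) ⟨
  #once ((x , y) ∷ s ++ segment x (suc y) (k + (l ∸ k)))
    ≡⟨ cong (λ es → #once ((x , y) ∷ s ++ es)) (segment-+ x (suc y) k (l ∸ k)) ⟩
  #once ((x , y) ∷ s ++ s ++ segment x (suc y + k) (l ∸ k))
    ≡⟨ #once-overlap x y k (l ∸ k) ⟩
  suc (l ∸ k)
    ≡⟨ cong (λ n → suc (n + (l ∸ k))) (m≤n⇒m∸n≡0 k≤l) ⟨
  suc ((k ∸ l) + (l ∸ k)) ∎
  where s = segment x (suc y) k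
... | inj₂ l≤k = begin
  #once ((x , y) ∷ segment x (suc y) k ++ s)
    ≡⟨ cong (λ n → #once ((x , y) ∷ segment x (suc y) n ++ s)) (m+[n∸m]≡n l≤k) ⟨
  #once ((x , y) ∷ segment x (suc y) (l + (k ∸ l)) ++ s)
    ≡⟨ cong (λ es → #once ((x , y) ∷ es ++ s)) (segment-+ x (suc y) l (k ∸ l)) ⟩
  #once ((x , y) ∷ (s ++ s′) ++ s)
    ≡⟨ #once-↭ (prep (x , y) (Perm.++-comm (s ++ s′) s)) ⟩
  #once ((x , y) ∷ s ++ s ++ s′)
    ≡⟨ #once-overlap x y l (k ∸ l) ⟩
  suc (k ∸ l)
    ≡⟨ cong suc (+-identityʳ (k ∸ l)) ⟨
  suc ((k ∸ l) + 0)
    ≡⟨ cong (λ n → suc ((k ∸ l) + n)) (m≤n⇒m∸n≡0 l≤k) ⟨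
  suc ((k ∸ l) + (l ∸ k)) ∎
  where
  s  = segment x (suc y) l
  s′ = segment x (suc y + l) (k ∸ l)

-- Edges column by column

concatMap-pair : ∀ {A B : Set} (f g : A → B) xs →
  concatMap (λ x → f x ∷ g x ∷ []) xs ↭ map f xs ++ map g xs
concatMap-pair f g []       = ↭-refl
concatMap-pair f g (x ∷ xs) = prep (f x) (↭-trans (prep (g x) (concatMap-pair f g xs))
  (↭-sym (shift (g x) (map f xs) (map g xs))))

column≡segment : ∀ x y (f : ℕ → Edge) h → (∀ j → f j ≡ (x , y + j)) → applyUpTo f h ≡ segment x y h
column≡segment x y f zero    eq = refl
column≡segment x y f (suc h) eq = cong₂ _∷_
  (trans (eq 0) (cong (x ,_) (+-identityʳ y)))
  (column≡segment x (suc y) (f ∘ suc) h (λ j → trans (eq (suc j)) (cong (x ,_) (+-suc y j))))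

map-column : ∀ i h x y (f : Cell → Edge) → (∀ j → f (i , i + j) ≡ (x , y + j)) →
  map f (map (λ j → i , i + j) (upTo h)) ≡ segment x y h
map-column i h x y f eq = begin
  map f (map (λ j → i , i + j) (upTo h)) ≡⟨ map-∘ (upTo h) ⟨
  map (λ j → f (i , i + j)) (upTo h)     ≡⟨ map-upTo _ h ⟩
  applyUpTo (λ j → f (i , i + j)) h      ≡⟨ column≡segment x y _ h eq ⟩
  segment x y h                          ∎

-- Serves both directions: `f` and `g` pick the lower and upper, or the left and right, edge of a
-- cell. Since a horizontal edge is named by its left endpoint, each of these families is a stack at
-- a single abscissa.
edges-∷ : ∀ (f g : Cell → Edge) i h hs x₁ y₁ x₂ y₂ →
  (∀ j → f (i , i + j) ≡ (x₁ , y₁ + j)) → (∀ j → g (i , i + j) ≡ (x₂ , y₂ + j)) →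
  let edges = concatMap (λ c → f c ∷ g c ∷ []) in
  edges (cellsFrom i (h ∷ hs))
    ↭ (segment x₁ y₁ h ++ segment x₂ y₂ h) ++ edges (cellsFrom (suc i) hs)
edges-∷ f g i h hs x₁ y₁ x₂ y₂ f-eq g-eq = ↭-trans
  (↭-reflexive (concatMap-++ _ column (cellsFrom (suc i) hs)))
  (Perm.++⁺ʳ _ (↭-trans (concatMap-pair f g column)
    (↭-reflexive (cong₂ _++_ (map-column i h x₁ y₁ f f-eq) (map-column i h x₂ y₂ g g-eq)))))
  where column = map (λ j → i , i + j) (upTo h)

horizontalEdgesFrom verticalEdgesFrom : ℕ → List ℕ → List Edge
horizontalEdgesFrom i hs = concatMap horizontalEdges (cellsFrom i hs)
verticalEdgesFrom   i hs = concatMap verticalEdges (cellsFrom i hs)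

horizontal-∷ : ∀ i h hs → horizontalEdgesFrom i (h ∷ hs)
  ↭ (segment i i h ++ segment i (suc i) h) ++ horizontalEdgesFrom (suc i) hs
horizontal-∷ i h hs = edges-∷ _ _ i h hs i i i (suc i) (λ _ → refl) (λ _ → refl)

vertical-∷ : ∀ i h hs → verticalEdgesFrom i (h ∷ hs)
  ↭ (segment i i h ++ segment (suc i) i h) ++ verticalEdgesFrom (suc i) hs
vertical-∷ i h hs = edges-∷ _ _ i h hs i i (suc i) i (λ _ → refl) (λ _ → refl)

RightOf : ℕ → Edge → Set
RightOf i e = i ≤ proj₁ e

segment-RightOf : ∀ {i} x y k → i ≤ x → All (RightOf i) (segment x y k)
segment-RightOf x y k i≤x = segment-All x y k (λ _ _ _ → i≤x)

horizontal-RightOf : ∀ i hs → All (RightOf i) (horizontalEdgesFrom i hs)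
horizontal-RightOf i []       = []
horizontal-RightOf i (h ∷ hs) = Perm.All-resp-↭ (↭-sym (horizontal-∷ i h hs))
  (++⁺ (++⁺ (segment-RightOf i i h ≤-refl) (segment-RightOf i (suc i) h ≤-refl))
       (All.map (≤-trans (n≤1+n i)) (horizontal-RightOf (suc i) hs)))

vertical-RightOf : ∀ i hs → All (RightOf i) (verticalEdgesFrom i hs)
vertical-RightOf i []       = []
vertical-RightOf i (h ∷ hs) = Perm.All-resp-↭ (↭-sym (vertical-∷ i h hs))
  (++⁺ (++⁺ (segment-RightOf i i h ≤-refl) (segment-RightOf (suc i) i h (n≤1+n i)))
       (All.map (≤-trans (n≤1+n i)) (vertical-RightOf (suc i) hs)))

segment-Disjoint : ∀ x y k {es} → All (RightOf (suc x)) es → Disjoint (segment x y k) es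
segment-Disjoint x y k right = segment-All x y k λ _ _ _ →
  All.map (λ x<e eq → <-irrefl (cong proj₁ eq) x<e) right

horizontal-length : ∀ i {hs} → IsHeightSequence hs → #once (horizontalEdgesFrom i hs) ≡ 2 * length hs
horizontal-column : ∀ i h hs → 1 ≤ h →
  #once (horizontalEdgesFrom i (h ∷ hs)) ≡ 2 + #once (horizontalEdgesFrom (suc i) hs)
horizontal-column i (suc k) hs 1≤h = begin
  #once (horizontalEdgesFrom i (suc k ∷ hs))
    ≡⟨ #once-↭ (horizontal-∷ i (suc k) hs) ⟩
  #once ((segment i i (suc k) ++ segment i (suc i) (suc k)) ++ rest)
    ≡⟨ #once-++ (segment i i (suc k) ++ segment i (suc i) (suc k)) rest
         (++⁺ (segment-Disjoint i i (suc k) right) (segment-Disjoint i (suc i) (suc k) right)) ⟩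
  #once (segment i i (suc k) ++ segment i (suc i) (suc k)) + #once rest
    -- Lower and upper edges of one column are two stacks of equal size shifted by one, as on the
    -- line between two columns of height `suc k`. Only the bottom and the top edge survive.
    ≡⟨ cong (_+ #once rest) (#once-adjacent i i k (suc k)) ⟩
  suc ((k ∸ suc k) + (suc k ∸ k)) + #once rest
    ≡⟨ cong₂ (λ a b → suc (a + b) + #once rest) (m≤n⇒m∸n≡0 (n≤1+n k)) (m+n∸n≡m 1 k) ⟩
  2 + #once rest ∎
  where
  rest = horizontalEdgesFrom (suc i) hs
  right = horizontal-RightOf (suc i) hs

horizontal-length i (final {h} 1≤h) = horizontal-column i h [] 1≤h
horizontal-length i (step {h} {h′} {hs} 2≤h hts) = begin
  #once (horizontalEdgesFrom i (h ∷ h′ ∷ hs))  ≡⟨ horizontal-column i h (h′ ∷ hs) (≤-trans (s≤s z≤n) 2≤h) ⟩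
  2 + #once (horizontalEdgesFrom (suc i) (h′ ∷ hs)) ≡⟨ cong (2 +_) (horizontal-length (suc i) hts) ⟩
  2 + 2 * length (h′ ∷ hs)                     ≡⟨ *-suc 2 (length (h′ ∷ hs)) ⟨
  2 * length (h ∷ h′ ∷ hs)                     ∎

-- The vertical semiperimeter in terms of heights

rise : List ℕ → ℕ
rise []            = 0
rise (h ∷ [])      = 0
rise (h ∷ h′ ∷ hs) = (suc h′ ∸ h) + rise (h′ ∷ hs)

semiperimeter : List ℕ → ℕ
semiperimeter []       = 0
semiperimeter (h ∷ hs) = h + rise (h ∷ hs)

-- Columns i and i + 1 share the line at abscissa i + 1, so the edges from column i + 1 on cannot be
-- counted separately. Keeping the right side of column i with them yields a family on which the
-- induction closes.
frontier : ℕ → ℕ → List ℕ → List Edge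
frontier i h hs = segment (suc i) i h ++ verticalEdgesFrom (suc i) hs

vertical-length-frontier : ∀ i {h hs} → IsHeightSequence (h ∷ hs) →
  h + #once (frontier i h hs) ≡ 2 * semiperimeter (h ∷ hs)
vertical-length-frontier i (final {h} _) = begin
  h + #once (segment (suc i) i h ++ [])   ≡⟨ cong (λ n → h + n) (#once-↭ (Perm.++-identityʳ (segment (suc i) i h))) ⟩
  h + #once (segment (suc i) i h)         ≡⟨ cong (h +_) (#once-segment (suc i) i h) ⟩
  h + h                                   ≡⟨ double h ⟩
  2 * (h + 0)                             ∎
  where
  double : ∀ h → h + h ≡ 2 * (h + 0)
  double = solve-∀
-- The added `h′` lets `max` rewrite `h′ + (k ∸ h′)` as `k + (h′ ∸ k)`, both being the maximum of
-- `k` and `h′`. The inner cancellation adds `h′` once more, because the induction hypothesis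
-- evaluates `h′ + F`.
vertical-length-frontier i (step {suc k} {h′} {hs} _ hts) = +-cancelʳ-≡ h′ _ _ (begin
  suc k + #once (frontier i (suc k) (h′ ∷ hs)) + h′
    ≡⟨ cong (λ n → suc k + n + h′) split ⟩
  suc k + (suc ((k ∸ h′) + (h′ ∸ k)) + F) + h′
    ≡⟨ regroup₁ k (k ∸ h′) (h′ ∸ k) F h′ ⟩
  2 + k + (h′ ∸ k) + (h′ + (k ∸ h′)) + F
    ≡⟨ cong (λ n → 2 + k + (h′ ∸ k) + n + F) max ⟩
  2 + k + (h′ ∸ k) + (k + (h′ ∸ k)) + F
    ≡⟨ +-cancelʳ-≡ h′ _ _ (trans (regroup₂ k (h′ ∸ k) F h′)
         (trans (cong (2 * suc k + 2 * (h′ ∸ k) +_) ih)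
           (regroup₃ k (h′ ∸ k) h′ (rise (h′ ∷ hs))))) ⟩
  2 * (suc k + ((h′ ∸ k) + rise (h′ ∷ hs))) + h′ ∎)
  where
  F = #once (frontier (suc i) h′ hs)
  ih = vertical-length-frontier (suc i) hts
  max : h′ + (k ∸ h′) ≡ k + (h′ ∸ k)
  max with ≤-total k h′
  ... | inj₁ k≤h′ = trans (cong (h′ +_) (m≤n⇒m∸n≡0 k≤h′)) (trans (+-identityʳ h′) (sym (m+[n∸m]≡n k≤h′)))
  ... | inj₂ h′≤k = trans (m+[n∸m]≡n h′≤k) (trans (sym (+-identityʳ k)) (cong (k +_) (sym (m≤n⇒m∸n≡0 h′≤k))))
  regroup₁ : ∀ k a b f h → suc k + (suc (a + b) + f) + h ≡ 2 + k + b + (h + a) + f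
  regroup₁ = solve-∀
  regroup₂ : ∀ k b f h → 2 + k + b + (k + b) + f + h ≡ 2 * suc k + 2 * b + (h + f)
  regroup₂ = solve-∀
  regroup₃ : ∀ k b h r → 2 * suc k + 2 * b + 2 * (h + r) ≡ 2 * (suc k + (b + r)) + h + h
  regroup₃ = solve-∀
  s₁ = segment (suc i) i (suc k)
  s₂ = segment (suc i) (suc i) h′
  right : All (RightOf (2 + i)) (frontier (suc i) h′ hs)
  right = ++⁺ (segment-RightOf (2 + i) (suc i) h′ ≤-refl) (vertical-RightOf (2 + i) hs)
  split : #once (frontier i (suc k) (h′ ∷ hs)) ≡ suc ((k ∸ h′) + (h′ ∸ k)) + F
  split = begin
    #once (s₁ ++ verticalEdgesFrom (suc i) (h′ ∷ hs))
      ≡⟨ #once-↭ (Perm.++⁺ˡ s₁ (vertical-∷ (suc i) h′ hs)) ⟩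
    #once (s₁ ++ (s₂ ++ segment (2 + i) (suc i) h′) ++ verticalEdgesFrom (2 + i) hs)
      ≡⟨ cong (λ es → #once (s₁ ++ es)) (++-assoc s₂ _ _) ⟩
    #once (s₁ ++ s₂ ++ frontier (suc i) h′ hs)
      ≡⟨ cong #once (++-assoc s₁ s₂ _) ⟨
    #once ((s₁ ++ s₂) ++ frontier (suc i) h′ hs)
      ≡⟨ #once-++ (s₁ ++ s₂) _ (++⁺ (segment-Disjoint (suc i) i (suc k) right)
           (segment-Disjoint (suc i) (suc i) h′ right)) ⟩
    #once (s₁ ++ s₂) + F
      ≡⟨ cong (_+ F) (#once-adjacent (suc i) i k h′) ⟩
    suc ((k ∸ h′) + (h′ ∸ k)) + F ∎

vertical-length : ∀ i {hs} → IsHeightSequence hs → #once (verticalEdgesFrom i hs) ≡ 2 * semiperimeter hs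
vertical-length i {h ∷ hs} hts = begin
  #once (verticalEdgesFrom i (h ∷ hs))
    ≡⟨ #once-↭ (vertical-∷ i h hs) ⟩
  #once ((segment i i h ++ segment (suc i) i h) ++ verticalEdgesFrom (suc i) hs)
    ≡⟨ cong #once (++-assoc (segment i i h) _ _) ⟩
  #once (segment i i h ++ frontier i h hs)
    ≡⟨ #once-++ (segment i i h) _ (segment-Disjoint i i h
         (++⁺ (segment-RightOf (suc i) i h ≤-refl) (vertical-RightOf (suc i) hs))) ⟩
  #once (segment i i h) + #once (frontier i h hs)
    ≡⟨ cong (_+ #once (frontier i h hs)) (#once-segment i i h) ⟩
  h + #once (frontier i h hs)
    ≡⟨ vertical-length-frontier i hts ⟩
  2 * semiperimeter (h ∷ hs) ∎

-- Height sequences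

-- The last height is either at least 2 or, after a final descent, equal to 1.
data End : ℕ → ℕ → ℕ → Set where
  tall : End 0 0 0
  unit : End 1 0 0

-- Run d e r g consists of the height sequences with first height 2 + g, having
-- d descents, e non-descents and rise e + r. Down and Up are those tails of
-- such sequences that follow a descent or a non-descent; skip lowers or raises
-- the candidate for the next height by one, stop accepts it.
data Run : ℕ → ℕ → ℕ → ℕ → Set
data Down : ℕ → ℕ → ℕ → ℕ → Set
data Up : ℕ → ℕ → ℕ → ℕ → Set

data Run where
  end  : ∀ {d e r g} → End d e r → Run d e r g
  down : ∀ {d e r g} → Down d e r g → Run d e r g
  up   : ∀ {d e r g} → Up d e r g → Run d e r g

data Down where
  skip : ∀ {d e r g} → Down (suc d) e r g → Down (suc d) e r (suc g)
  stop : ∀ {d e r g} → Run d e r g → Down (suc d) e r (suc g)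

data Up where
  stop : ∀ {d e r g} → Run d e r g → Up d (suc e) r g
  skip : ∀ {d e r g} → Up d (suc e) r (suc g) → Up d (suc e) (suc r) g

runTail : ∀ {d e r g} → Run d e r g → List ℕ
downHead : ∀ {d e r g} → Down d e r g → ℕ
downTail : ∀ {d e r g} → Down d e r g → List ℕ
upHead : ∀ {d e r g} → Up d e r g → ℕ
upTail : ∀ {d e r g} → Up d e r g → List ℕ
runTail (end tall) = []
runTail (end unit) = 1 ∷ []
runTail (down x)   = 2 + downHead x ∷ downTail x
runTail (up y)     = 2 + upHead y ∷ upTail y
downHead (skip x)     = downHead x
downHead (stop {g = g} f) = g
downTail (skip x) = downTail x
downTail (stop f) = runTail f
upHead (stop {g = g} f) = g
upHead (skip y)     = upHead y
upTail (stop f) = runTail f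
upTail (skip y) = upTail y

downHead< : ∀ {d e r g} (x : Down d e r g) → downHead x < g
downHead< (skip x) = m≤n⇒m≤1+n (downHead< x)
downHead< (stop f) = ≤-refl

≤upHead : ∀ {d e r g} (y : Up d e r g) → g ≤ upHead y
≤upHead (stop f) = ≤-refl
≤upHead (skip y) = <⇒≤ (≤upHead y)

heads≡ : ∀ {a b : ℕ} {as bs : List ℕ} → 2 + a ∷ as ≡ 2 + b ∷ bs → a ≡ b
heads≡ eq = suc-injective (suc-injective (proj₁ (∷-injective eq)))

-- A next height below the current one forces `down`, any other forces `up`, and its distance from
-- the candidate fixes the number of `skip`s. Hence the list leaves no choice of constructors.
runTail-injective : ∀ {d e r g} (x x′ : Run d e r g) → runTail x ≡ runTail x′ → x ≡ x′
down-injective : ∀ {d e r g} (x x′ : Down d e r g) →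
  downHead x ≡ downHead x′ → downTail x ≡ downTail x′ → x ≡ x′
up-injective : ∀ {d e r g} (x x′ : Up d e r g) →
  upHead x ≡ upHead x′ → upTail x ≡ upTail x′ → x ≡ x′
runTail-injective (end tall) (end tall) eq = refl
runTail-injective (end unit) (end unit) eq = refl
runTail-injective (end tall) (down x′) ()
runTail-injective (end unit) (down x′) ()
runTail-injective (end tall) (up y′)   ()
runTail-injective (end unit) (up y′)   ()
runTail-injective (down x) (end tall) ()
runTail-injective (down x) (end unit) ()
runTail-injective (up y)   (end tall) ()
runTail-injective (up y)   (end unit) ()
runTail-injective (down x) (down x′) eq =
  cong down (down-injective x x′ (heads≡ eq) (proj₂ (∷-injective eq)))
runTail-injective (up y)   (up y′)   eq =
  cong up (up-injective y y′ (heads≡ eq) (proj₂ (∷-injective eq)))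
runTail-injective (down x) (up y′)   eq =
  contradiction (heads≡ eq) (<⇒≢ (<-≤-trans (downHead< x) (≤upHead y′)))
runTail-injective (up y)   (down x′) eq =
  contradiction (sym (heads≡ eq)) (<⇒≢ (<-≤-trans (downHead< x′) (≤upHead y)))
down-injective (skip x) (skip x′) eqₕ eqₜ = cong skip (down-injective x x′ eqₕ eqₜ)
down-injective (stop f) (stop f′) eqₕ eqₜ = cong stop (runTail-injective f f′ eqₜ)
down-injective (skip x) (stop f′) eqₕ eqₜ = contradiction eqₕ (<⇒≢ (downHead< x))
down-injective (stop f) (skip x′) eqₕ eqₜ = contradiction (sym eqₕ) (<⇒≢ (downHead< x′))
up-injective (skip y) (skip y′) eqₕ eqₜ = cong skip (up-injective y y′ eqₕ eqₜ)
up-injective (stop f) (stop f′) eqₕ eqₜ = cong stop (runTail-injective f f′ eqₜ)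
up-injective (skip y) (stop f′) eqₕ eqₜ = contradiction (sym eqₕ) (<⇒≢ (≤upHead y))
up-injective (stop f) (skip y′) eqₕ eqₜ = contradiction eqₕ (<⇒≢ (≤upHead y′))

record Profile (d e r h : ℕ) (hs : List ℕ) : Set where
  constructor profile
  field
    isHeights : IsHeightSequence (h ∷ hs)
    length≡   : length hs ≡ d + e
    rise≡     : rise (h ∷ hs) ≡ e + r
    descents≡ : descents (h ∷ hs) ≡ d

descend : ∀ {d e r h h′ hs} → 2 ≤ h → h′ < h → Profile d e r h′ hs → Profile (suc d) e r h (h′ ∷ hs)
descend {e = e} {r} {h} {h′} {hs} 2≤h h′<h (profile ht len ri de) = profile (step 2≤h ht) (cong suc len)
  (cong₂ _+_ (m≤n⇒m∸n≡0 h′<h) ri)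
  (cong₂ (λ b n → (if b then 1 else 0) + n) (dec-true (h′ <? h) h′<h) de)

ascend : ∀ {d e r h h′ hs} c → 2 ≤ h → h + c ≡ h′ → Profile d e r h′ hs →
  Profile d (suc e) (r + c) h (h′ ∷ hs)
ascend {d} {e} {r} {h} {_} {hs} c 2≤h refl (profile ht len ri de) = profile (step 2≤h ht)
  (trans (cong suc len) (sym (+-suc d e)))
  (begin
    (suc (h + c) ∸ h) + rise (h + c ∷ hs) ≡⟨ cong₂ (λ n → n ∸ h +_) (sym (+-suc h c)) ri ⟩
    (h + suc c ∸ h) + (e + r)             ≡⟨ cong (_+ (e + r)) (m+n∸m≡n h (suc c)) ⟩
    suc c + (e + r)                       ≡⟨ regroup c e r ⟩
    suc e + (r + c)                       ∎)
  (cong₂ (λ b n → (if b then 1 else 0) + n) (dec-false (h + c <? h) (m+n≮m h c)) de)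
  where
  regroup : ∀ c e r → suc c + (e + r) ≡ suc e + (r + c)
  regroup = solve-∀

2≤2+g : ∀ {g} → 2 ≤ 2 + g
2≤2+g = s≤s (s≤s z≤n)

run-profile : ∀ {d e r g} (f : Run d e r g) → Profile d e r (2 + g) (runTail f)
-- The preceding column keeps its height `2 + k` while `skip` moves the candidate `g` away from it.
-- In `up-profile`, `c` is the number of units skipped so far, all of which belong to the excess of
-- the step from the preceding column.
down-profile : ∀ {d e r g} (x : Down d e r g) k → g ≤ k →
  Profile d e r (2 + k) (2 + downHead x ∷ downTail x)
up-profile : ∀ {d e r g} (y : Up d e r g) k c → k + c ≡ g →
  Profile d e (r + c) (2 + k) (2 + upHead y ∷ upTail y)
run-profile (end tall) = profile (final (s≤s z≤n)) refl refl refl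
run-profile {g = g} (end unit) =
  descend 2≤2+g (s≤s (s≤s z≤n)) (profile (final ≤-refl) refl refl refl)
run-profile (down x)   = down-profile x _ ≤-refl
run-profile {d} {e} {r} {g} (up y) =
  subst (λ r → Profile d e r (2 + g) (runTail (up y))) (+-identityʳ r) (up-profile y g 0 (+-identityʳ g))
down-profile (skip x) k g<k = down-profile x k (<⇒≤ g<k)
down-profile (stop f) k g<k = descend 2≤2+g (s≤s (s≤s g<k)) (run-profile f)
up-profile (stop f) k c eq = ascend c 2≤2+g (cong (2 +_) eq) (run-profile f)
up-profile {d} {e} (skip {r = r} y) k c eq = subst (λ r → Profile d e r (2 + k) (2 + upHead y ∷ upTail y)) (+-suc r c)
  (up-profile y k (suc c) (trans (+-suc k c) (cong suc eq)))

-- An element of Up d (suc e) t 0 is a height sequence behind a fictitious column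
-- of height 2, so that all first heights are counted at once.
upHeights : ∀ {d e r g} → Up d e r g → List ℕ
upHeights y = 2 + upHead y ∷ upTail y

record Shape (hs : List ℕ) (d e t : ℕ) : Set where
  constructor shape
  field
    isHeights      : IsHeightSequence hs
    length≡        : length hs ≡ suc (d + e)
    semiperimeter≡ : semiperimeter hs ≡ 2 + (e + t)
    descents≡      : descents hs ≡ d

-- Each `skip` trades a unit of `r` for a unit of `g`, so `r + g` is invariant until `stop`, where
-- it is the excess plus the first height less 2. This makes one `Up` at `g = 0` collect all first
-- heights for a fixed semiperimeter.
upHeights-shape : ∀ {d e r g} (y : Up d (suc e) r g) → Shape (upHeights y) d e (r + g)
upHeights-shape {d} {e} {r} {g} (stop f) = let open Profile (run-profile f) in
  shape isHeights (cong suc length≡) (trans (cong (2 + g +_) rise≡) (regroup e r g)) descents≡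
  where
  regroup : ∀ e r g → 2 + g + (e + r) ≡ 2 + (e + (r + g))
  regroup = solve-∀
upHeights-shape {d} {e} {g = g} (skip {r = r} y) =
  subst (Shape (upHeights y) d e) (+-suc r g) (upHeights-shape y)

-- The order relations mirror the constructors: `≤′` steps at its upper end, as `skip` of `Down`
-- does, whereas `≤‴` in `above` steps at its lower end, as `skip` of `Up` does.
below : ∀ {d e r g g′} → g′ ≤′ g → (f : Run d e r g′) →
  Σ[ x ∈ Down (suc d) e r (suc g) ] (downHead x ≡ g′ × downTail x ≡ runTail f)
below (≤′-reflexive refl) f = stop f , refl , refl
below (≤′-step p)         f with x , eqₕ , eqₜ ← below p f = skip x , eqₕ , eqₜ

above : ∀ {d e r g g′} → g ≤‴ g′ → (f : Run d e r g′) →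
  ∃[ s ] Σ[ y ∈ Up d (suc e) s g ] (upHead y ≡ g′ × upTail y ≡ runTail f)
above (≤‴-reflexive refl) f = _ , stop f , refl , refl
above (≤‴-step p)         f with _ , y , eqₕ , eqₜ ← above p f = _ , skip y , eqₕ , eqₜ

runTail-surjective : ∀ {g hs} → IsHeightSequence (2 + g ∷ hs) →
  ∃[ d ] ∃[ e ] ∃[ r ] Σ[ f ∈ Run d e r g ] runTail f ≡ hs
runTail-surjective (final _) = _ , _ , _ , end tall , refl
runTail-surjective (step {h′ = 1} _ (final _)) = _ , _ , _ , end unit , refl
runTail-surjective (step {h′ = 1} _ (step (s≤s ()) _))
runTail-surjective (step {h′ = 0} _ (final ()))
runTail-surjective (step {h′ = 0} _ (step () _))
runTail-surjective {g} (step {h′ = suc (suc g′)} _ ht) with runTail-surjective ht | g′ <? g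
... | _ , _ , _ , f , refl | yes (s≤s g′≤g) with x , eqₕ , eqₜ ← below (≤⇒≤′ g′≤g) f =
  _ , _ , _ , down x , cong₂ (λ a as → 2 + a ∷ as) eqₕ eqₜ
... | _ , _ , _ , f , refl | no g′≮g with _ , y , eqₕ , eqₜ ← above (≤⇒≤‴ (≮⇒≥ g′≮g)) f =
  _ , _ , _ , up y , cong₂ (λ a as → 2 + a ∷ as) eqₕ eqₜ

upHeights-surjective : ∀ {g hs} → IsHeightSequence (2 + g ∷ hs) →
  ∃[ d ] ∃[ e ] ∃[ t ] Σ[ y ∈ Up d (suc e) t 0 ] upHeights y ≡ 2 + g ∷ hs
upHeights-surjective {g} ht with _ , _ , _ , f , refl ← runTail-surjective ht
  with _ , y , eqₕ , eqₜ ← above {g = 0} (≤⇒≤‴ z≤n) f =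
  _ , _ , _ , y , cong₂ (λ a as → 2 + a ∷ as) eqₕ eqₜ

upHeights-injective : ∀ {d e r g} (y y′ : Up d e r g) → upHeights y ≡ upHeights y′ → y ≡ y′
upHeights-injective y y′ eq = up-injective y y′ (heads≡ eq) (proj₂ (∷-injective eq))

-- Polyominoes with given semiperimeters and descents

IsHeightSequence-irrelevant : ∀ {hs} (p q : IsHeightSequence hs) → p ≡ q
IsHeightSequence-irrelevant (final p)  (final q)  = cong final (≤-irrelevant p q)
IsHeightSequence-irrelevant (step p x) (step q y) =
  cong₂ step (≤-irrelevant p q) (IsHeightSequence-irrelevant x y)

𝓕-≡ : ∀ m n (P Q : 𝓕 m n) → heights (proj₁ P) ≡ heights (proj₁ Q) → P ≡ Q
𝓕-≡ m n (polyomino hs x , a , b) (polyomino .hs y , a′ , b′) refl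
  with refl ← IsHeightSequence-irrelevant x y
  with refl ← ≡-irrelevant a a′ | refl ← ≡-irrelevant b b′ = refl

𝓕-length : ∀ m n (P : 𝓕 m n) → length (heights (proj₁ P)) ≡ m
𝓕-length m n (polyomino hs ht , h , v) = *-cancelˡ-≡ _ _ 2 (trans (sym (horizontal-length 1 ht)) h)

𝓕-semiperimeter : ∀ m n (P : 𝓕 m n) → semiperimeter (heights (proj₁ P)) ≡ n
𝓕-semiperimeter m n (polyomino hs ht , h , v) = *-cancelˡ-≡ _ _ 2 (trans (sym (vertical-length 1 ht)) v)

mk𝓕 : ∀ {m n hs} → IsHeightSequence hs → length hs ≡ m → semiperimeter hs ≡ n → 𝓕 m n
mk𝓕 {hs = hs} ht len semi = polyomino hs ht ,
  trans (horizontal-length 1 ht) (cong (2 *_) len) , trans (vertical-length 1 ht) (cong (2 *_) semi)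

Class : ℕ → ℕ → ℕ → Set
Class m n d = Σ[ P ∈ 𝓕 m n ] des (proj₁ P) ≡ d

classHeights : ∀ m n d → Class m n d → List ℕ
classHeights m n d (P , _) = heights (proj₁ P)

classHeights-injective : ∀ m n d (P Q : Class m n d) →
  classHeights m n d P ≡ classHeights m n d Q → P ≡ Q
classHeights-injective m n d (P , a) (Q , b) eq
  with refl ← 𝓕-≡ m n P Q eq with refl ← ≡-irrelevant a b = refl

-- With at least two columns the first height is at least 2, as `upHeights` requires. The equations
-- for `e` and `t` determine both by cancellation, which later allows comparison with prescribed
-- indices.
decompose : ∀ m n d (P : Class (2 + m) (2 + n) d) →
  ∃[ e ] ∃[ t ] (d + e ≡ suc m × e + t ≡ n ×
    Σ[ y ∈ Up d (suc e) t 0 ] upHeights y ≡ classHeights (2 + m) (2 + n) d P)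
decompose m n d (P@(polyomino _ (final _) , _) , _) =
  contradiction (suc-injective (𝓕-length (2 + m) (2 + n) P)) λ ()
decompose m n _ (P@(polyomino _ (step (s≤s (s≤s z≤n)) ht) , _) , refl)
  with d , e , t , y , eq ← upHeights-surjective (step (s≤s (s≤s z≤n)) ht)
  with shape _ len semi refl ← subst₂ (λ hs → Shape hs d e) eq (+-identityʳ t) (upHeights-shape y) =
  e , t , suc-injective (trans (sym len) (𝓕-length (2 + m) (2 + n) P)) ,
  suc-injective (suc-injective (trans (sym semi) (𝓕-semiperimeter (2 + m) (2 + n) P))) , y , eq

module _ {m n d e t} (m-eq : d + e ≡ suc m) (n-eq : e + t ≡ n) where

  fromUp : Up d (suc e) t 0 → Class (2 + m) (2 + n) d
  fromUp y = mk𝓕 isHeights (trans length≡ (cong suc m-eq))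
    (trans semiperimeter≡ (cong (2 +_) n-eq)) , descents≡
    where open Shape (subst (Shape (upHeights y) d e) (+-identityʳ t) (upHeights-shape y))

  toUp : (P : Class (2 + m) (2 + n) d) →
    Σ[ y ∈ Up d (suc e) t 0 ] upHeights y ≡ classHeights (2 + m) (2 + n) d P
  toUp P
    with e′ , t′ , m-eq′ , n-eq′ , y ← decompose m n d P
    with refl ← +-cancelˡ-≡ d e e′ (trans m-eq (sym m-eq′))
    with refl ← +-cancelˡ-≡ e t t′ (trans n-eq (sym n-eq′)) = y

  Class↔Up : Class (2 + m) (2 + n) d ↔ Up d (suc e) t 0
  Class↔Up = mk↔ₛ′ (proj₁ ∘ toUp) fromUp
    (λ y → upHeights-injective (proj₁ (toUp (fromUp y))) y (proj₂ (toUp (fromUp y))))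
    (λ P → classHeights-injective (2 + m) (2 + n) d (fromUp (proj₁ (toUp P))) P (proj₂ (toUp P)))

-- Recurrences

-- ε d is the number of admissible endings with d descents.
module Count (ε : ℕ → ℕ) where

  ends : ℕ → ℕ → ℕ → ℕ
  ends d zero    zero    = ε d
  ends d zero    (suc r) = 0
  ends d (suc e) r       = 0

  runs downs ups : ℕ → ℕ → ℕ → ℕ → ℕ
  runs d e r g = ends d e r + (downs d e r g + ups d e r g)
  downs zero    e r g       = 0
  downs (suc d) e r zero    = 0
  downs (suc d) e r (suc g) = downs (suc d) e r g + runs d e r g
  ups d zero    r       g = 0
  ups d (suc e) zero    g = runs d e 0 g
  ups d (suc e) (suc r) g = runs d e (suc r) g + ups d (suc e) r (suc g)

-- The closed form belongs to sequences with last height at least 2; `allEnds` also admits the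
-- ending of height 1, which brings one more descent. Thus `allEnds` is `tallEnds` plus its shift by
-- one in `d`.
tallEnds : ℕ → ℕ
tallEnds zero    = 1
tallEnds (suc d) = 0

allEnds : ℕ → ℕ
allEnds zero          = 1
allEnds (suc zero)    = 1
allEnds (suc (suc d)) = 0

open Count tallEnds
module Total = Count allEnds

-- Counting by bijections

⊎↔Fin : ∀ {A : Set} {m} → A ↔ Fin m → ∀ {B : Set} {n} → B ↔ Fin n → (A ⊎ B) ↔ Fin (m + n)
⊎↔Fin f g = ↔-trans (f ⊎-↔ g) (↔-sym +↔⊎)

empty↔Fin0 : ∀ {A : Set} → ¬ A → A ↔ Fin 0
empty↔Fin0 ¬a = mk↔ₛ′ (⊥-elim ∘ ¬a) (λ ()) (λ ()) (⊥-elim ∘ ¬a)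

singleton↔Fin1 : ∀ {A : Set} (a : A) → (∀ x → a ≡ x) → A ↔ Fin 1
singleton↔Fin1 a unique = ↔-trans (mk↔ₛ′ (λ _ → tt) (λ _ → a) (λ _ → refl) unique) (↔-sym 1↔⊤)

End↔Fin : ∀ d e r → End d e r ↔ Fin (Total.ends d e r)
End↔Fin zero          zero    zero    = singleton↔Fin1 tall λ { tall → refl }
End↔Fin (suc zero)    zero    zero    = singleton↔Fin1 unit λ { unit → refl }
End↔Fin (suc (suc d)) zero    zero    = empty↔Fin0 λ ()
End↔Fin d             zero    (suc r) = empty↔Fin0 λ ()
End↔Fin d             (suc e) r       = empty↔Fin0 λ ()

Run↔ : ∀ {d e r g} → Run d e r g ↔ (End d e r ⊎ (Down d e r g ⊎ Up d e r g))
Run↔ = mk↔ₛ′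
  (λ { (end x) → inj₁ x ; (down x) → inj₂ (inj₁ x) ; (up x) → inj₂ (inj₂ x) })
  (λ { (inj₁ x) → end x ; (inj₂ (inj₁ x)) → down x ; (inj₂ (inj₂ x)) → up x })
  (λ { (inj₁ x) → refl ; (inj₂ (inj₁ x)) → refl ; (inj₂ (inj₂ x)) → refl })
  (λ { (end x) → refl ; (down x) → refl ; (up x) → refl })

Down↔ : ∀ {d e r g} → Down (suc d) e r (suc g) ↔ (Down (suc d) e r g ⊎ Run d e r g)
Down↔ = mk↔ₛ′
  (λ { (skip x) → inj₁ x ; (stop x) → inj₂ x }) (λ { (inj₁ x) → skip x ; (inj₂ x) → stop x })
  (λ { (inj₁ x) → refl ; (inj₂ x) → refl }) (λ { (skip x) → refl ; (stop x) → refl })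

Up↔zero : ∀ {d e g} → Up d (suc e) 0 g ↔ Run d e 0 g
Up↔zero = mk↔ₛ′ (λ { (stop x) → x }) stop (λ _ → refl) (λ { (stop x) → refl })

Up↔suc : ∀ {d e r g} → Up d (suc e) (suc r) g ↔ (Run d e (suc r) g ⊎ Up d (suc e) r (suc g))
Up↔suc = mk↔ₛ′
  (λ { (stop x) → inj₁ x ; (skip x) → inj₂ x }) (λ { (inj₁ x) → stop x ; (inj₂ x) → skip x })
  (λ { (inj₁ x) → refl ; (inj₂ x) → refl }) (λ { (stop x) → refl ; (skip x) → refl })

Run↔Fin : ∀ d e r g → Run d e r g ↔ Fin (Total.runs d e r g)
Down↔Fin : ∀ d e r g → Down d e r g ↔ Fin (Total.downs d e r g)
Up↔Fin : ∀ d e r g → Up d e r g ↔ Fin (Total.ups d e r g)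
Run↔Fin d e r g = ↔-trans Run↔
  (⊎↔Fin (End↔Fin d e r) (⊎↔Fin (Down↔Fin d e r g) (Up↔Fin d e r g)))
Down↔Fin zero    e r g       = empty↔Fin0 λ ()
Down↔Fin (suc d) e r zero    = empty↔Fin0 λ ()
Down↔Fin (suc d) e r (suc g) = ↔-trans Down↔ (⊎↔Fin (Down↔Fin (suc d) e r g) (Run↔Fin d e r g))
Up↔Fin d zero    r       g = empty↔Fin0 λ ()
Up↔Fin d (suc e) zero    g = ↔-trans Up↔zero (Run↔Fin d e 0 g)
Up↔Fin d (suc e) (suc r) g = ↔-trans Up↔suc (⊎↔Fin (Run↔Fin d e (suc r) g) (Up↔Fin d (suc e) r (suc g)))

-- Binomial identities

pascal : ∀ n k → suc n C suc k ≡ n C k + n C suc k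
pascal n k = sym (nCk+nC[k+1]≡[n+1]C[k+1] n k)

-- (k+1) C(n,k+1) = (n−k) C(n,k), with the subtracted term moved across.
step-binomial : ∀ n k → suc k * (n C suc k) + k * (n C k) ≡ n * (n C k)
step-binomial zero    zero    = refl
step-binomial zero    (suc k) = cong₂ _+_ (*-zeroʳ k) (*-zeroʳ k)
step-binomial (suc n) zero    = begin
  1 * (suc n C 1) + 0 ≡⟨ cong (λ c → 1 * c + 0) (nC1≡n (suc n)) ⟩
  1 * suc n + 0       ≡⟨ units n ⟩
  suc n * 1           ∎
  where
  units : ∀ n → 1 * suc n + 0 ≡ suc n * 1
  units = solve-∀
step-binomial (suc n) (suc k) = begin
  (2 + k) * (suc n C (2 + k)) + suc k * (suc n C suc k)
    ≡⟨ cong₂ (λ x y → (2 + k) * x + suc k * y) (pascal n (suc k)) (pascal n k) ⟩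
  (2 + k) * (b + c) + suc k * (a + b)
    ≡⟨ split k a b c ⟩
  (((2 + k) * c + suc k * b) + (suc k * b + k * a)) + (a + b)
    ≡⟨ cong (_+ (a + b)) (cong₂ _+_ (step-binomial n (suc k)) (step-binomial n k)) ⟩
  (n * b + n * a) + (a + b)
    ≡⟨ collect n a b ⟩
  suc n * (a + b)
    ≡⟨ cong (suc n *_) (pascal n k) ⟨
  suc n * (suc n C suc k) ∎
  where
  a = n C k
  b = n C suc k
  c = n C suc (suc k)
  split : ∀ k a b c → (2 + k) * (b + c) + suc k * (a + b)
        ≡ (((2 + k) * c + suc k * b) + (suc k * b + k * a)) + (a + b)
  split = solve-∀
  collect : ∀ n a b → (n * b + n * a) + (a + b) ≡ suc n * (a + b)
  collect = solve-∀

step-binomial-+ : ∀ k j → suc k * ((k + j) C suc k) ≡ j * ((k + j) C k)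
step-binomial-+ k j = +-cancelʳ-≡ (k * ((k + j) C k)) _ _ (begin
  suc k * ((k + j) C suc k) + k * ((k + j) C k) ≡⟨ step-binomial (k + j) k ⟩
  (k + j) * ((k + j) C k)                       ≡⟨ *-distribʳ-+ ((k + j) C k) k j ⟩
  k * ((k + j) C k) + j * ((k + j) C k)         ≡⟨ +-comm (k * ((k + j) C k)) _ ⟩
  j * ((k + j) C k) + k * ((k + j) C k)         ∎)

absorption : ∀ n k → suc k * (suc n C suc k) ≡ suc n * (n C k)
absorption n k = begin
  suc k * (suc n C suc k)                           ≡⟨ cong (suc k *_) (pascal n k) ⟩
  suc k * (n C k + n C suc k)                       ≡⟨ regroup k (n C k) (n C suc k) ⟩
  n C k + (suc k * (n C suc k) + k * (n C k))       ≡⟨ cong (n C k +_) (step-binomial n k) ⟩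
  suc n * (n C k)                                   ∎
  where
  regroup : ∀ k a b → suc k * (a + b) ≡ a + (suc k * b + k * a)
  regroup = solve-∀

-- Both sides count pairs of disjoint subsets of sizes `x` and `z` in a set of `x + y` points. The
-- induction on `x` multiplies by `suc x` and lets `absorption` move this factor through.
trinomial-revision : ∀ x y z → ((x + y) C x) * (y C z) ≡ ((x + y) C (x + z)) * ((x + z) C x)
trinomial-revision zero    y z = *-comm 1 (y C z)
trinomial-revision (suc x) y z = *-cancelˡ-≡ _ _ (suc x) (begin
  suc x * ((suc (x + y) C suc x) * (y C z))
    ≡⟨ *-assoc (suc x) (suc (x + y) C suc x) (y C z) ⟨
  suc x * (suc (x + y) C suc x) * (y C z)
    ≡⟨ cong (_* (y C z)) (absorption (x + y) x) ⟩
  suc (x + y) * ((x + y) C x) * (y C z)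
    ≡⟨ *-assoc (suc (x + y)) ((x + y) C x) (y C z) ⟩
  suc (x + y) * (((x + y) C x) * (y C z))
    ≡⟨ cong (suc (x + y) *_) (trinomial-revision x y z) ⟩
  suc (x + y) * (((x + y) C (x + z)) * ((x + z) C x))
    ≡⟨ *-assoc (suc (x + y)) ((x + y) C (x + z)) ((x + z) C x) ⟨
  suc (x + y) * ((x + y) C (x + z)) * ((x + z) C x)
    ≡⟨ cong (_* ((x + z) C x)) (absorption (x + y) (x + z)) ⟨
  suc (x + z) * (suc (x + y) C suc (x + z)) * ((x + z) C x)
    ≡⟨ swap (suc (x + z)) (suc (x + y) C suc (x + z)) ((x + z) C x) ⟩
  (suc (x + y) C suc (x + z)) * (suc (x + z) * ((x + z) C x))
    ≡⟨ cong ((suc (x + y) C suc (x + z)) *_) (absorption (x + z) x) ⟨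
  (suc (x + y) C suc (x + z)) * (suc x * (suc (x + z) C suc x))
    ≡⟨ swap′ (suc (x + y) C suc (x + z)) (suc x) (suc (x + z) C suc x) ⟩
  suc x * ((suc (x + y) C suc (x + z)) * (suc (x + z) C suc x)) ∎)
  where
  swap : ∀ a b c → a * b * c ≡ b * (a * c)
  swap = solve-∀
  swap′ : ∀ a b c → a * (b * c) ≡ b * (a * c)
  swap′ = solve-∀

-- The number of ways to write r as an ordered sum of e naturals.
weakCompositions : ℕ → ℕ → ℕ
weakCompositions zero    zero    = 1
weakCompositions zero    (suc r) = 0
weakCompositions (suc e) r       = (e + r) C e

weakCompositions-zeroʳ : ∀ e → weakCompositions e 0 ≡ 1
weakCompositions-zeroʳ zero    = refl
weakCompositions-zeroʳ (suc e) = trans (cong (_C e) (+-identityʳ e)) (nCn≡1 e)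

weakCompositions-suc : ∀ e r → weakCompositions (suc e) (suc r)
                             ≡ weakCompositions e (suc r) + weakCompositions (suc e) r
weakCompositions-suc zero    r = refl
weakCompositions-suc (suc e) r = begin
  suc (e + suc r) C suc e                 ≡⟨ pascal (e + suc r) e ⟩
  (e + suc r) C e + (e + suc r) C suc e   ≡⟨ cong (λ n → (e + suc r) C e + n C suc e) (+-suc e r) ⟩
  (e + suc r) C e + suc (e + r) C suc e   ∎

-- c stands for C(d + e, d − 1), which is 0 for d = 0.
narayana-determinant : ∀ d e c →
  suc e * c ≡ d * ((d + e) C d) → suc (d + e) C d ≡ c + (d + e) C d →
  narayana (suc (d + e)) (suc d) + ((d + e) C suc d) * c ≡ ((d + e) C d) * ((d + e) C d)
-- The factor `suc m` clears the division in the Narayana number. What remains follows from the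
-- ratios of neighbouring binomials, (d + 1) b = e a and (e + 1) c = d a, each used twice.
narayana-determinant d e c c-step c-pascal = *-cancelˡ-≡ _ _ (suc m) (begin
  suc m * (N + b * c)
    ≡⟨ regroup₁ (suc m) N b c ⟩
  N * suc m + suc m * (b * c)
    ≡⟨ cong (_+ suc m * (b * c)) (m/n*n≡m (narayana-exact m d)) ⟩
  (suc m C suc d) * (suc m C d) + suc m * (b * c)
    ≡⟨ cong₂ (λ x y → x * y + suc m * (b * c)) (pascal m d) c-pascal ⟩
  (a + b) * (c + a) + suc m * (b * c)
    ≡⟨ regroup₂ d e a b c ⟩
  a * a + (a * b + a * c + (c * (suc d * b) + b * (suc e * c)))
    ≡⟨ cong₂ (λ x y → a * a + (a * b + a * c + (c * x + b * y))) (step-binomial-+ d e) c-step ⟩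
  a * a + (a * b + a * c + (c * (e * a) + b * (d * a)))
    ≡⟨ regroup₃ d e a b c ⟩
  a * a + a * (suc d * b + suc e * c)
    ≡⟨ cong₂ (λ x y → a * a + a * (x + y)) (step-binomial-+ d e) c-step ⟩
  a * a + a * (e * a + d * a)
    ≡⟨ regroup₄ d e a ⟩
  suc m * (a * a) ∎)
  where
  m = d + e
  a = m C d
  b = m C suc d
  N = narayana (suc m) (suc d)
  regroup₁ : ∀ s n b c → s * (n + b * c) ≡ n * s + s * (b * c)
  regroup₁ = solve-∀
  regroup₂ : ∀ d e a b c → (a + b) * (c + a) + suc (d + e) * (b * c)
           ≡ a * a + (a * b + a * c + (c * (suc d * b) + b * (suc e * c)))
  regroup₂ = solve-∀
  regroup₃ : ∀ d e a b c → a * a + (a * b + a * c + (c * (e * a) + b * (d * a)))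
           ≡ a * a + a * (suc d * b + suc e * c)
  regroup₃ = solve-∀
  regroup₄ : ∀ d e a → a * a + a * (e * a + d * a) ≡ suc (d + e) * (a * a)
  regroup₄ = solve-∀

narayana-zero : ∀ e → narayana (suc e) 1 ≡ 1
narayana-zero e = begin
  narayana (suc e) 1                 ≡⟨ +-identityʳ _ ⟨
  narayana (suc e) 1 + 0             ≡⟨ cong (narayana (suc e) 1 +_) (*-zeroʳ (e C 1)) ⟨
  narayana (suc e) 1 + (e C 1) * 0   ≡⟨ narayana-determinant 0 e 0 (*-zeroʳ (suc e)) refl ⟩
  1                                  ∎

narayana-suc : ∀ d e → let m = suc d + e in
  narayana (suc m) (2 + d) + (m C (2 + d)) * (m C d) ≡ (m C suc d) * (m C suc d)
narayana-suc d e = narayana-determinant (suc d) e _ c-step (pascal (suc d + e) d)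
  where
  c-step : suc e * ((suc d + e) C d) ≡ suc d * ((suc d + e) C suc d)
  c-step = begin
    suc e * ((suc d + e) C d)     ≡⟨ cong (λ n → suc e * (n C d)) (+-suc d e) ⟨
    suc e * ((d + suc e) C d)     ≡⟨ step-binomial-+ d (suc e) ⟨
    suc d * ((d + suc e) C suc d) ≡⟨ cong (λ n → suc d * (n C suc d)) (+-suc d e) ⟩
    suc d * ((suc d + e) C suc d) ∎

-- Closed forms

-- Forgetting that the heights stay at least 2, the sequences counted by runs
-- number C(d + e, d) * free d e r g: choose the positions of the descents, the
-- excesses of the e rises, and the drops together with the last height.
-- Those violating the bound number C(d + e, d + 1) * reflected d e r g.
free : ℕ → ℕ → ℕ → ℕ → ℕ
free d e r g = weakCompositions e r * ((g + r) C d)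

reflected : ℕ → ℕ → ℕ → ℕ → ℕ
reflected zero    e r       g = 0
reflected (suc d) e zero    g = 0
reflected (suc d) e (suc r) g = weakCompositions (suc e) r * ((g + r) C d)

free-down : ∀ d e r g → free (suc d) e r (suc g) ≡ free (suc d) e r g + free d e r g
free-down d e r g = begin
  w * (suc (g + r) C suc d)                 ≡⟨ cong (w *_) (pascal (g + r) d) ⟩
  w * ((g + r) C d + (g + r) C suc d)       ≡⟨ cong (w *_) (+-comm ((g + r) C d) _) ⟩
  w * ((g + r) C suc d + (g + r) C d)       ≡⟨ *-distribˡ-+ w _ _ ⟩
  free (suc d) e r g + free d e r g         ∎
  where w = weakCompositions e r

-- `reflected (suc d) e (suc r) g` unfolds to `free d (suc e) r g`: one descent becomes a
-- non-descent at the cost of one unit of excess. So the recurrences of `free` carry over, with the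
-- degenerate values treated apart.
reflected-down : ∀ d e r g →
  reflected (suc d) e r (suc g) ≡ reflected (suc d) e r g + reflected d e r g
reflected-down zero    e zero    g = refl
reflected-down (suc d) e zero    g = refl
reflected-down zero    e (suc r) g = sym (+-identityʳ _)
reflected-down (suc d) e (suc r) g = free-down d (suc e) r g

free-up-zero : ∀ d e g → free d (suc e) 0 g ≡ free d e 0 g
free-up-zero d e g = cong (_* ((g + 0) C d))
  (trans (weakCompositions-zeroʳ (suc e)) (sym (weakCompositions-zeroʳ e)))

reflected-up-zero : ∀ d e g → reflected d (suc e) 0 g ≡ reflected d e 0 g
reflected-up-zero zero    e g = refl
reflected-up-zero (suc d) e g = refl

free-up-suc : ∀ d e r g →
  free d (suc e) (suc r) g ≡ free d e (suc r) g + free d (suc e) r (suc g)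
free-up-suc d e r g = begin
  weakCompositions (suc e) (suc r) * ((g + suc r) C d)
    ≡⟨ cong (_* ((g + suc r) C d)) (weakCompositions-suc e r) ⟩
  (weakCompositions e (suc r) + weakCompositions (suc e) r) * ((g + suc r) C d)
    ≡⟨ *-distribʳ-+ ((g + suc r) C d) (weakCompositions e (suc r)) _ ⟩
  free d e (suc r) g + weakCompositions (suc e) r * ((g + suc r) C d)
    ≡⟨ cong (λ n → free d e (suc r) g + weakCompositions (suc e) r * (n C d)) (+-suc g r) ⟩
  free d e (suc r) g + free d (suc e) r (suc g) ∎

reflected-up-suc : ∀ d e r g →
  reflected d (suc e) (suc r) g ≡ reflected d e (suc r) g + reflected d (suc e) r (suc g)
reflected-up-suc zero    e r       g = refl
reflected-up-suc (suc d) e zero    g = trans (free-up-zero d (suc e) g) (sym (+-identityʳ _))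
reflected-up-suc (suc d) e (suc r) g = free-up-suc d (suc e) r g

-- At g = 0 no descent is possible, so all sequences starting with one are bad.
free≡reflected : ∀ d e r →
  ((d + e) C suc d) * reflected (suc d) e r 0 ≡ ((d + e) C d) * free (suc d) e r 0
free≡reflected d e zero = begin
  ((d + e) C suc d) * 0                         ≡⟨ *-zeroʳ ((d + e) C suc d) ⟩
  0                                             ≡⟨ *-zeroʳ ((d + e) C d) ⟨
  ((d + e) C d) * 0                             ≡⟨ cong (((d + e) C d) *_) (*-zeroʳ (weakCompositions e 0)) ⟨
  ((d + e) C d) * (weakCompositions e 0 * 0)    ∎
free≡reflected d zero (suc r) = begin
  ((d + 0) C suc d) * x   ≡⟨ cong (_* x) (k>n⇒nCk≡0 (s≤s (≤-reflexive (+-identityʳ d)))) ⟩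
  0                       ≡⟨ *-zeroʳ ((d + 0) C d) ⟨
  ((d + 0) C d) * 0       ∎
  where x = reflected (suc d) 0 (suc r) 0
free≡reflected d (suc e) (suc r) = *-cancelˡ-≡ _ _ (suc d * suc e) (begin
  suc d * suc e * (p₁ * (((suc e + r) C suc e) * (r C d)))
    ≡⟨ regroup₁ (suc d) (suc e) p₁ ((suc e + r) C suc e) (r C d) ⟩
  suc d * p₁ * ((suc e * ((suc e + r) C suc e)) * (r C d))
    ≡⟨ cong₂ (λ x y → x * (y * (r C d))) (step-binomial-+ d (suc e)) q-step ⟩
  suc e * p₀ * ((suc r * q₀) * (r C d))
    ≡⟨ regroup₂ (suc e) (suc r) p₀ q₀ (r C d) ⟩
  suc e * p₀ * (q₀ * (suc r * (r C d)))
    ≡⟨ cong (λ x → suc e * p₀ * (q₀ * x)) (absorption r d) ⟨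
  suc e * p₀ * (q₀ * (suc d * (suc r C suc d)))
    ≡⟨ regroup₃ (suc d) (suc e) p₀ q₀ (suc r C suc d) ⟩
  suc d * suc e * (p₀ * (q₀ * (suc r C suc d))) ∎)
  where
  p₀ = (d + suc e) C d
  p₁ = (d + suc e) C suc d
  q₀ = (e + suc r) C e
  q-step : suc e * ((suc e + r) C suc e) ≡ suc r * q₀
  q-step = trans (cong (λ n → suc e * (n C suc e)) (sym (+-suc e r))) (step-binomial-+ e (suc r))
  regroup₁ : ∀ d e p q c → d * e * (p * (q * c)) ≡ d * p * ((e * q) * c)
  regroup₁ = solve-∀
  regroup₂ : ∀ e r p q c → e * p * ((r * q) * c) ≡ e * p * (q * (r * c))
  regroup₂ = solve-∀
  regroup₃ : ∀ d e p q c → e * p * (q * (d * c)) ≡ d * e * (p * (q * c))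
  regroup₃ = solve-∀

-- Additivity of a = p u - q x for fixed `p` and `q`, written without subtraction. It applies
-- because along `skip` and `stop` the coefficients stay the same.
combine : ∀ {a b q x y p u v} → a + q * x ≡ p * u → b + q * y ≡ p * v →
          (a + b) + q * (x + y) ≡ p * (u + v)
combine {a} {b} {q} {x} {y} {p} {u} {v} h₁ h₂ = begin
  (a + b) + q * (x + y)       ≡⟨ regroup a b q x y ⟩
  (a + q * x) + (b + q * y)   ≡⟨ cong₂ _+_ h₁ h₂ ⟩
  p * u + p * v               ≡⟨ *-distribˡ-+ p u v ⟨
  p * (u + v)                 ∎
  where
  regroup : ∀ a b q x y → (a + b) + q * (x + y) ≡ (a + q * x) + (b + q * y)
  regroup = solve-∀

-- The coefficients are binomials in the number of steps whose kind is still open. In `downs-closed`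
-- and `ups-closed` the kind of the first step is settled, so one descent or one non-descent is left
-- out of them; adding the two cases is Pascal's rule.
runs-closed : ∀ d e r g →
  runs d e r g + ((d + e) C suc d) * reflected d e r g ≡ ((d + e) C d) * free d e r g
downs-closed : ∀ d e r g →
  downs (suc d) e r g + ((d + e) C suc d) * reflected (suc d) e r g
    ≡ ((d + e) C d) * free (suc d) e r g
ups-closed : ∀ d e r g →
  ups d (suc e) r g + ((d + e) C suc d) * reflected d (suc e) r g
    ≡ ((d + e) C d) * free d (suc e) r g

runs-closed zero    zero    zero    g = refl
runs-closed zero    zero    (suc r) g = refl
-- Without non-descents both coefficients of the reflected term vanish and both coefficients of the
-- free term are 1.
runs-closed (suc d) zero    r       g = begin
  runs (suc d) 0 r g + ((suc d + 0) C (2 + d)) * x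
    ≡⟨ cong₂ (λ y z → y + z * x) (runs≡downs r)
         (trans (k>n⇒nCk≡0 (s≤s (s≤s d+0≤d))) (sym (k>n⇒nCk≡0 (s≤s d+0≤d)))) ⟩
  downs (suc d) 0 r g + ((d + 0) C suc d) * x
    ≡⟨ downs-closed d 0 r g ⟩
  ((d + 0) C d) * free (suc d) 0 r g
    ≡⟨ cong (_* free (suc d) 0 r g) (trans (top d) (sym (top (suc d)))) ⟩
  ((suc d + 0) C suc d) * free (suc d) 0 r g ∎
  where
  x = reflected (suc d) 0 r g
  d+0≤d = ≤-reflexive (+-identityʳ d)
  top : ∀ d → (d + 0) C d ≡ 1
  top d = trans (cong (_C d) (+-identityʳ d)) (nCn≡1 d)
  runs≡downs : ∀ r → runs (suc d) 0 r g ≡ downs (suc d) 0 r g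
  runs≡downs zero    = +-identityʳ _
  runs≡downs (suc r) = +-identityʳ _
runs-closed zero    (suc e) r       g = begin
  ups 0 (suc e) r g + (suc e C 1) * 0   ≡⟨ cong (ups 0 (suc e) r g +_) (trans (*-zeroʳ (suc e C 1)) (sym (*-zeroʳ (e C 1)))) ⟩
  ups 0 (suc e) r g + (e C 1) * 0       ≡⟨ ups-closed 0 e r g ⟩
  (e C 0) * free 0 (suc e) r g          ∎
runs-closed (suc d) (suc e) r       g = begin
  (X + Y) + (suc (d + suc e) C (2 + d)) * v
    ≡⟨ cong (λ c → (X + Y) + c * v) (pascal (d + suc e) (suc d)) ⟩
  (X + Y) + ((d + suc e) C suc d + (d + suc e) C (2 + d)) * v
    ≡⟨ cong (λ n → (X + Y) + ((d + suc e) C suc d + n C (2 + d)) * v) (+-suc d e) ⟩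
  (X + Y) + ((d + suc e) C suc d + suc (d + e) C (2 + d)) * v
    ≡⟨ regroup X Y ((d + suc e) C suc d) (suc (d + e) C (2 + d)) v ⟩
  (X + ((d + suc e) C suc d) * v) + (Y + (suc (d + e) C (2 + d)) * v)
    ≡⟨ cong₂ _+_ (downs-closed d (suc e) r g) (ups-closed (suc d) e r g) ⟩
  ((d + suc e) C d) * u + (suc (d + e) C suc d) * u
    ≡⟨ *-distribʳ-+ u ((d + suc e) C d) _ ⟨
  ((d + suc e) C d + suc (d + e) C suc d) * u
    ≡⟨ cong (λ n → ((d + suc e) C d + n C suc d) * u) (+-suc d e) ⟨
  ((d + suc e) C d + (d + suc e) C suc d) * u
    ≡⟨ cong (_* u) (pascal (d + suc e) d) ⟨
  (suc (d + suc e) C suc d) * u ∎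
  where
  X = downs (suc d) (suc e) r g
  Y = ups (suc d) (suc e) r g
  u = free (suc d) (suc e) r g
  v = reflected (suc d) (suc e) r g
  regroup : ∀ x y p q v → (x + y) + (p + q) * v ≡ (x + p * v) + (y + q * v)
  regroup = solve-∀

downs-closed d e r zero    = free≡reflected d e r
downs-closed d e r (suc g) = begin
  downs (suc d) e r (suc g) + q * reflected (suc d) e r (suc g)
    ≡⟨ cong (λ x → downs (suc d) e r (suc g) + q * x) (reflected-down d e r g) ⟩
  downs (suc d) e r (suc g) + q * (reflected (suc d) e r g + reflected d e r g)
    ≡⟨ combine {downs (suc d) e r g} {q = q} {p = p} (downs-closed d e r g) (runs-closed d e r g) ⟩
  p * (free (suc d) e r g + free d e r g)
    ≡⟨ cong (p *_) (free-down d e r g) ⟨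
  p * free (suc d) e r (suc g) ∎
  where
  p = (d + e) C d
  q = (d + e) C suc d

ups-closed d e zero    g = begin
  runs d e 0 g + q * reflected d (suc e) 0 g ≡⟨ cong (λ x → runs d e 0 g + q * x) (reflected-up-zero d e g) ⟩
  runs d e 0 g + q * reflected d e 0 g       ≡⟨ runs-closed d e 0 g ⟩
  p * free d e 0 g                           ≡⟨ cong (p *_) (free-up-zero d e g) ⟨
  p * free d (suc e) 0 g                     ∎
  where
  p = (d + e) C d
  q = (d + e) C suc d
ups-closed d e (suc r) g = begin
  ups d (suc e) (suc r) g + q * reflected d (suc e) (suc r) g
    ≡⟨ cong (λ x → ups d (suc e) (suc r) g + q * x) (reflected-up-suc d e r g) ⟩
  ups d (suc e) (suc r) g + q * (reflected d e (suc r) g + reflected d (suc e) r (suc g))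
    ≡⟨ combine {runs d e (suc r) g} {q = q} {p = p} (runs-closed d e (suc r) g) (ups-closed d e r (suc g)) ⟩
  p * (free d e (suc r) g + free d (suc e) r (suc g))
    ≡⟨ cong (p *_) (free-up-suc d e r g) ⟨
  p * free d (suc e) (suc r) g ∎
  where
  p = (d + e) C d
  q = (d + e) C suc d

C-sym : ∀ a b → (a + b) C a ≡ (a + b) C b
C-sym a b = trans (nCk≡nC[n∸k] (m≤m+n a b)) (cong ((a + b) C_) (m+n∸m≡n a b))

-- Trinomial revision isolates the factor C(e + t, d + e), that is C(n - 2, m - 1). `reflected≡`
-- isolates the same factor, so it can be taken out of the difference.
free≡ : ∀ d e t → free d (suc e) t 0 ≡ ((e + t) C (d + e)) * ((d + e) C d)
free≡ d e t = begin
  ((e + t) C e) * (t C d)               ≡⟨ trinomial-revision e t d ⟩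
  ((e + t) C (e + d)) * ((e + d) C e)   ≡⟨ cong (((e + t) C (e + d)) *_) (C-sym e d) ⟩
  ((e + t) C (e + d)) * ((e + d) C d)   ≡⟨ cong (λ n → ((e + t) C n) * (n C d)) (+-comm e d) ⟩
  ((e + t) C (d + e)) * ((d + e) C d)   ∎

reflected≡ : ∀ d e t →
  reflected (suc d) (suc e) t 0 ≡ ((e + t) C (suc d + e)) * ((suc d + e) C d)
reflected≡ d e zero    = sym (cong (_* ((suc d + e) C d))
  (k>n⇒nCk≡0 (s≤s (≤-trans (≤-reflexive (+-identityʳ e)) (m≤n+m e d)))))
reflected≡ d e (suc t) = begin
  free d (2 + e) t 0
    ≡⟨ free≡ d (suc e) t ⟩
  ((suc e + t) C (d + suc e)) * ((d + suc e) C d)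
    ≡⟨ cong₂ (λ x y → (x C y) * (y C d)) (sym (+-suc e t)) (+-suc d e) ⟩
  ((e + suc t) C (suc d + e)) * ((suc d + e) C d) ∎

ups≡narayana : ∀ d e t →
  ups d (suc e) t 0 ≡ narayana (suc (d + e)) (suc d) * ((e + t) C (d + e))
ups≡narayana zero e t = begin
  ups 0 (suc e) t 0                        ≡⟨ +-identityʳ _ ⟨
  ups 0 (suc e) t 0 + 0                    ≡⟨ cong (ups 0 (suc e) t 0 +_) (*-zeroʳ (e C 1)) ⟨
  ups 0 (suc e) t 0 + (e C 1) * 0          ≡⟨ ups-closed 0 e t 0 ⟩
  1 * (((e + t) C e) * 1)                  ≡⟨ cong (1 *_) (*-identityʳ ((e + t) C e)) ⟩
  1 * ((e + t) C e)                        ≡⟨ cong (_* ((e + t) C e)) (narayana-zero e) ⟨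
  narayana (suc e) 1 * ((e + t) C e)       ∎
ups≡narayana (suc d) e t = +-cancelʳ-≡ (b * (x * c)) _ _ (begin
  ups (suc d) (suc e) t 0 + b * (x * c)
    ≡⟨ cong (λ y → ups (suc d) (suc e) t 0 + b * y) (reflected≡ d e t) ⟨
  ups (suc d) (suc e) t 0 + b * reflected (suc d) (suc e) t 0
    ≡⟨ ups-closed (suc d) e t 0 ⟩
  a * free (suc d) (suc e) t 0
    ≡⟨ cong (a *_) (free≡ (suc d) e t) ⟩
  a * (x * a)
    ≡⟨ regroup₁ a x ⟩
  a * a * x
    ≡⟨ cong (_* x) (narayana-suc d e) ⟨
  (N + b * c) * x
    ≡⟨ regroup₂ N b c x ⟩
  N * x + b * (x * c) ∎)
  where
  m = suc d + e
  a = m C suc d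
  b = m C (2 + d)
  c = m C d
  x = (e + t) C m
  N = narayana (suc m) (2 + d)
  regroup₁ : ∀ a x → a * (x * a) ≡ a * a * x
  regroup₁ = solve-∀
  regroup₂ : ∀ n b c x → (n + b * c) * x ≡ n * x + b * (x * c)
  regroup₂ = solve-∀

-- Admitting a last column of height 1

runs-zero : ∀ e r g → Total.runs 0 e r g ≡ runs 0 e r g
ups-zero : ∀ e r g → Total.ups 0 e r g ≡ ups 0 e r g
runs-zero zero    zero    g = refl
runs-zero zero    (suc r) g = refl
runs-zero (suc e) r       g = ups-zero (suc e) r g
ups-zero zero    r       g = refl
ups-zero (suc e) zero    g = runs-zero e 0 g
ups-zero (suc e) (suc r) g = cong₂ _+_ (runs-zero e (suc r) g) (ups-zero (suc e) r (suc g))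

exchange : ∀ a b c d → (a + b) + (c + d) ≡ (a + c) + (b + d)
exchange = solve-∀

-- The recurrences are linear in the weights of the endings and commute with a shift in `d`, so the
-- splitting of `allEnds` is inherited by their solutions.
runs-suc : ∀ d e r g → Total.runs (suc d) e r g ≡ runs (suc d) e r g + runs d e r g
downs-suc : ∀ d e r g → Total.downs (suc d) e r g ≡ downs (suc d) e r g + downs d e r g
ups-suc : ∀ d e r g → Total.ups (suc d) e r g ≡ ups (suc d) e r g + ups d e r g

runs-suc d e r g = begin
  Total.ends (suc d) e r + (Total.downs (suc d) e r g + Total.ups (suc d) e r g)
    ≡⟨ cong₂ _+_ (ends-suc d e r) (cong₂ _+_ (downs-suc d e r g) (ups-suc d e r g)) ⟩
  (ends (suc d) e r + ends d e r) + ((downs (suc d) e r g + downs d e r g) + (ups (suc d) e r g + ups d e r g))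
    ≡⟨ regroup (ends (suc d) e r) (ends d e r) (downs (suc d) e r g) (downs d e r g) (ups (suc d) e r g) (ups d e r g) ⟩
  runs (suc d) e r g + runs d e r g ∎
  where
  regroup : ∀ a b c d e f → (a + b) + ((c + d) + (e + f)) ≡ (a + (c + e)) + (b + (d + f))
  regroup = solve-∀
  ends-suc : ∀ d e r → Total.ends (suc d) e r ≡ ends (suc d) e r + ends d e r
  ends-suc zero    zero    zero    = refl
  ends-suc (suc d) zero    zero    = refl
  ends-suc d       zero    (suc r) = refl
  ends-suc d       (suc e) r       = refl
downs-suc zero    e r zero    = refl
downs-suc (suc d) e r zero    = refl
downs-suc zero    e r (suc g) = begin
  Total.downs 1 e r g + Total.runs 0 e r g        ≡⟨ cong₂ _+_ (downs-suc 0 e r g) (runs-zero e r g) ⟩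
  (downs 1 e r g + 0) + runs 0 e r g        ≡⟨ move (downs 1 e r g) (runs 0 e r g) ⟩
  (downs 1 e r g + runs 0 e r g) + 0        ∎
  where
  move : ∀ a b → (a + 0) + b ≡ (a + b) + 0
  move = solve-∀
downs-suc (suc d) e r (suc g) = begin
  Total.downs (2 + d) e r g + Total.runs (suc d) e r g
    ≡⟨ cong₂ _+_ (downs-suc (suc d) e r g) (runs-suc d e r g) ⟩
  (downs (2 + d) e r g + downs (suc d) e r g) + (runs (suc d) e r g + runs d e r g)
    ≡⟨ exchange (downs (2 + d) e r g) (downs (suc d) e r g) (runs (suc d) e r g) (runs d e r g) ⟩
  downs (2 + d) e r (suc g) + downs (suc d) e r (suc g) ∎
ups-suc d zero    r       g = refl
ups-suc d (suc e) zero    g = runs-suc d e 0 g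
ups-suc d (suc e) (suc r) g = begin
  Total.runs (suc d) e (suc r) g + Total.ups (suc d) (suc e) r (suc g)
    ≡⟨ cong₂ _+_ (runs-suc d e (suc r) g) (ups-suc d (suc e) r (suc g)) ⟩
  (runs (suc d) e (suc r) g + runs d e (suc r) g) + (ups (suc d) (suc e) r (suc g) + ups d (suc e) r (suc g))
    ≡⟨ exchange (runs (suc d) e (suc r) g) (runs d e (suc r) g) (ups (suc d) (suc e) r (suc g)) (ups d (suc e) r (suc g)) ⟩
  ups (suc d) (suc e) (suc r) g + ups d (suc e) (suc r) g ∎

total : ∀ m d e t → d + e ≡ suc m → Total.ups d (suc e) t 0
  ≡ narayana (2 + m) (suc d) * ((e + t) C suc m) + narayana (suc m) d * ((e + t) C m)
total m zero    e t refl = begin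
  Total.ups 0 (suc e) t 0                               ≡⟨ ups-zero (suc e) t 0 ⟩
  ups 0 (suc e) t 0                         ≡⟨ ups≡narayana 0 e t ⟩
  -- The second summand carries the factor `narayana (suc m) 0`, which reduces to 0.
  narayana (suc e) 1 * ((e + t) C e)                 ≡⟨ +-identityʳ _ ⟨
  narayana (suc e) 1 * ((e + t) C e) + 0             ∎
total m (suc d) e t refl = begin
  Total.ups (suc d) (suc e) t 0                         ≡⟨ ups-suc d (suc e) t 0 ⟩
  ups (suc d) (suc e) t 0 + ups d (suc e) t 0
    ≡⟨ cong₂ _+_ (ups≡narayana (suc d) e t) (ups≡narayana d e t) ⟩
  narayana (suc (suc d + e)) (2 + d) * ((e + t) C (suc d + e)) + narayana (suc (d + e)) (suc d) * ((e + t) C (d + e)) ∎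

-- Parameters out of range and the final count

count : ℕ → ℕ → ℕ → ℕ
count m n d = narayana (2 + m) (suc d) * (n C suc m) + narayana (suc m) d * (n C m)

k>n⇒narayana≡0 : ∀ {n k} → k > n → narayana n k ≡ 0
k>n⇒narayana≡0 {zero}  {k}     _   = refl
k>n⇒narayana≡0 {suc n} {suc k} k>n =
  cong (λ c → c * (suc n C k) / suc n) (k>n⇒nCk≡0 k>n)

count-vanishes-d : ∀ m n d → suc m < d → count m n d ≡ 0
count-vanishes-d m n d m<d =
  cong₂ (λ x y → x * (n C suc m) + y * (n C m)) (k>n⇒narayana≡0 (s≤s m<d)) (k>n⇒narayana≡0 m<d)

-- For positive `d`, `e ≤ m` and both binomials vanish. For `d = 0` the binomial `n C m` can be 1,
-- at `n = m`, but its coefficient `narayana (suc m) 0` is 0.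
count-vanishes-e : ∀ m n d e → d + e ≡ suc m → n < e → count m n d ≡ 0
count-vanishes-e m n zero    e refl n<e = trans (+-identityʳ _)
  (trans (cong (narayana (2 + m) 1 *_) (k>n⇒nCk≡0 n<e)) (*-zeroʳ (narayana (2 + m) 1)))
count-vanishes-e m n (suc d) e refl n<e = begin
  a * (n C suc (d + e)) + b * (n C (d + e)) ≡⟨ cong₂ (λ x y → a * x + b * y) (k>n⇒nCk≡0 (m≤n⇒m≤1+n n<m)) (k>n⇒nCk≡0 n<m) ⟩
  a * 0 + b * 0                             ≡⟨ cong₂ _+_ (*-zeroʳ a) (*-zeroʳ b) ⟩
  0                                         ∎
  where
  a = narayana (2 + m) (2 + d)
  b = narayana (suc m) (suc d)
  n<m : n < d + e
  n<m = ≤-trans n<e (m≤n+m e d)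

-- An index `t` with `e + t ≡ n` exists only if `e ≤ n`. Otherwise the forced units of rise already
-- exceed the semiperimeter, the class is empty, and the formula has to give 0 as well.
Class↔Fin-+ : ∀ m n d e → d + e ≡ suc m → Class (2 + m) (2 + n) d ↔ Fin (count m n d)
Class↔Fin-+ m n d e m-eq with e ≤? n
... | yes e≤n = subst (λ k → Class (2 + m) (2 + n) d ↔ Fin k)
  (trans (total m d e (n ∸ e) m-eq) (cong (λ n → count m n d) (m+[n∸m]≡n e≤n)))
  (↔-trans (Class↔Up m-eq (m+[n∸m]≡n e≤n)) (Up↔Fin d (suc e) (n ∸ e) 0))
... | no e≰n = subst (λ k → Class (2 + m) (2 + n) d ↔ Fin k) (sym (count-vanishes-e m n d e m-eq (≰⇒> e≰n)))
  (empty↔Fin0 (e≰n ∘ e≤n))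
  where
  e≤n : Class (2 + m) (2 + n) d → e ≤ n
  e≤n P with e′ , t , m-eq′ , n-eq , _ ← decompose m n d P
    with refl ← +-cancelˡ-≡ d e e′ (trans m-eq (sym m-eq′)) = subst (e ≤_) n-eq (m≤m+n e t)

Class↔Fin : ∀ m n d → Class (2 + m) (2 + n) d ↔ Fin (count m n d)
Class↔Fin m n d with d ≤? suc m
... | yes d≤1+m = Class↔Fin-+ m n d (suc m ∸ d) (m+[n∸m]≡n d≤1+m)
... | no  d≰1+m = subst (λ k → Class (2 + m) (2 + n) d ↔ Fin k) (sym (count-vanishes-d m n d (≰⇒> d≰1+m)))
  (empty↔Fin0 (d≰1+m ∘ d≤1+m))
  where
  d≤1+m : Class (2 + m) (2 + n) d → d ≤ suc m
  d≤1+m P with e , _ , m-eq , _ ← decompose m n d P = subst (d ≤_) m-eq (m≤m+n d e)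

singleColumn : ∀ n → 1 ≤ n →
  Σ[ P ∈ 𝓕 1 n ] ((∀ (Q : 𝓕 1 n) → Q ≡ P) × des (proj₁ P) ≡ 0)
singleColumn n 1≤n = P , (λ Q → 𝓕-≡ 1 n Q P (unique Q)) , refl
  where
  P : 𝓕 1 n
  P = mk𝓕 (final 1≤n) refl (+-identityʳ n)
  unique : (Q : 𝓕 1 n) → heights (proj₁ Q) ≡ n ∷ []
  unique Q@(polyomino (h ∷ []) _ , _) =
    cong (_∷ []) (trans (sym (+-identityʳ h)) (𝓕-semiperimeter 1 n Q))
  unique Q@(polyomino (h ∷ h′ ∷ hs) _ , _) = contradiction (suc-injective (𝓕-length 1 n Q)) λ ()

corollary4p2 : (∀ (m n d : ℕ) → 2 ≤ m → 2 ≤ n →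
    (Σ[ P ∈ 𝓕 m n ] des (proj₁ P) ≡ d)
    ↔ Fin (narayana m (d + 1) * ((n ∸ 2) C (m ∸ 1)) + narayana (m ∸ 1) d * ((n ∸ 2) C (m ∸ 2))))
    ×
    (∀ (n : ℕ) → 1 ≤ n →
    Σ[ P ∈ 𝓕 1 n ] ((∀ (Q : 𝓕 1 n) → Q ≡ P) × des (proj₁ P) ≡ 0))
corollary4p2 = classes , singleColumn
  where
  classes : ∀ (m n d : ℕ) → 2 ≤ m → 2 ≤ n → Class m n d
    ↔ Fin (narayana m (d + 1) * ((n ∸ 2) C (m ∸ 1)) + narayana (m ∸ 1) d * ((n ∸ 2) C (m ∸ 2)))
  classes (suc (suc m)) (suc (suc n)) d (s≤s (s≤s _)) (s≤s (s≤s _)) =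
    subst (λ k → Class (2 + m) (2 + n) d ↔ Fin (narayana (2 + m) k * (n C suc m) + narayana (suc m) d * (n C m)))
      (+-comm 1 d) (Class↔Fin m n d)
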